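{- Let $F$ be a nonsingular unsatisfiable hitting clause-set which is clause-reducible, and let $F=(F_0,C)\diamond G$ be a nontrivial clause-factorisation. Let $k:=\delta(F)$ (so $k\ge 2$). (1) If $F$ is strictly fs-resolvable, then $n(F)\le \mathrm{N}(k-1)+3$. (2) Otherwise $n(F)\le \mathrm{N}(\delta(F_0))+\mathrm{N}(\delta(G))+|\mathrm{var}(F_0)\cap\mathrm{var}(G)|+1$. (3) Assume that $\mathrm{N}(k')=4k'-5$ for all integers $k'$ with $2\le k'<k$. (a) If $F$ is strictly fs-resolvable, then $n(F)\le 4k-6$. (b) Otherwise $n(F)\le 4k-5-3\cdot|\mathrm{var}(F_0)\cap\mathrm{var}(G)|\le 4k-5$.
   Context: Variables are positive integers, literals are nonzero integers, the complement of $x$ is $\overline{x}=-x$, and $\mathrm{var}(x)=|x|$. A clause is a finite set of literals with no pair $x,\overline{x}$; $\bot$ is the empty clause. A clause-set is a finite set of clauses; $\top$ is the empty clause-set. $\mathrm{var}(F)$ is the set of variables occurring in $F$, $n(F)=|\mathrm{var}(F)|$, $c(F)=|F|$, $\delta(F)=c(F)-n(F)$. $F$ is satisfiable if some clause meets every clause of $F$, otherwise unsatisfiable. $F$ is hitting if any two distinct clauses $C,D\in F$ have some $x\in C$ with $\overline{x}\in D$. $\mathrm{ldeg}_F(x)$ is the number of clauses containing $x$; $v\in\mathrm{var}(F)$ is singular if $\min(\mathrm{ldeg}_F(v),\mathrm{ldeg}_F(\overline v))=1$; $F$ is nonsingular if it has no singular variables. $\mathrm{N}(k)\in\mathbb{N}_0\cup\{+\infty\}$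 is the supremum of $n(F)$ over nonsingular unsatisfiable hitting clause-sets with $\delta(F)=k$. Clause-factors: a clause-set $F'\ne\top$ is a clause-factor if $\{D\setminus\bigcap F':D\in F'\}$ is unsatisfiable; a clause-factor of $F$ is a subset of $F$ which is a clause-factor; it is trivial if $c(F')=1$ or ($F'$ unsatisfiable and $F'=F$); $F$ is clause-reducible if it has a nontrivial clause-factor. Clause-factorisation: for clause-sets $F_0,G$ and $C\in F_0$, $(F_0,C)\diamond G:=(F_0\setminus\{C\})\cup\{C\cup D: D\in G, C\cap\overline{D}=\emptyset\}$. This is a clause-factorisation if $\mathrm{var}(C)\cap\mathrm{var}(G)=\emptyset$, the two sets in the union are disjoint, and $G$ is unsatisfiable; it is nontrivial if $F_0\ne\{\bot\}$ and $G\ne\{\bot\}$. Full-subsumption: an fs-pair is a pair of clauses $\{E\cup\{v\},E\cup\{\overline v\}\}$ with $v,\overline v\notin E$; fs-resolution on $F$ replaces an fs-pair $\{E\cup\{v\},E\cup\{\overline v\}\}\subseteq F$ with $E\notin F$ by $E$; it is strict if the resulting clause-set has the same set of variables as $F$. $F$ is strictly fs-resolvable if a strict fs-resolution is possible on $F$. -}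

module Defs where

open import Data.Nat as ℕ using (ℕ; _≤_)
open import Data.Integer as ℤ using (ℤ; +_; -_; ∣_∣; _-_)
open import Data.List using (List; []; _∷_; _++_; map; concat; length; filter; deduplicate)
open import Data.List.Relation.Unary.All using (All; all?)
open import Data.List.Relation.Unary.Any using (Any)
open import Data.List.Relation.Unary.AllPairs using (AllPairs)
open import Data.List.Membership.Propositional using (_∈_; _∉_)
open import Data.List.Relation.Binary.Subset.Propositional using (_⊆_)
import Data.List.Membership.DecPropositional as DecMem
open import Data.Product using (Σ; ∃; _×_; _,_)
open import Data.Sum using (_⊎_)
open import Relation.Nullary using (¬_; ¬?)
open import Relation.Binary.PropositionalEquality using (_≡_; _≢_)
open import Function.Bundles using (_⇔_)

-- Literals are nonzero integers; variables are positive naturals.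
Lit : Set
Lit = ℤ

-- A clause is represented by a list of literals, read as the finite SET of its
-- elements (order and repetitions are irrelevant; equality is set equality).
Clause : Set
Clause = List Lit

-- A clause-set is represented by a list of clauses, read as a finite set of clauses.
ClauseSet : Set
ClauseSet = List Clause

open DecMem ℤ._≟_ using (_∈?_)
open DecMem ℕ._≟_ using () renaming (_∈?_ to _∈ℕ?_)

_≈c_ : Clause → Clause → Set
C ≈c D = (C ⊆ D) × (D ⊆ C)

_∈c_ : Clause → ClauseSet → Set
C ∈c F = Any (C ≈c_) F

_⊆cs_ : ClauseSet → ClauseSet → Set
F ⊆cs G = All (λ C → C ∈c G) F

_≈cs_ : ClauseSet → ClauseSet → Set
F ≈cs G = (F ⊆cs G) × (G ⊆cs F)

IsClause : Clause → Set
IsClause C = All (λ x → x ≢ + 0) C × (∀ x → x ∈ C → - x ∉ C)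

-- well-formed clause-set: every clause well-formed, and the list entries are
-- pairwise distinct as sets (so c(F) = length F)
IsClauseSet : ClauseSet → Set
IsClauseSet F = All IsClause F × AllPairs (λ C D → ¬ (C ≈c D)) F

varList : ClauseSet → List ℕ
varList F = deduplicate ℕ._≟_ (map ∣_∣ (concat F))

varC : Clause → List ℕ
varC C = map ∣_∣ C

n : ClauseSet → ℕ
n F = length (varList F)

c : ClauseSet → ℕ
c F = length F

δ : ClauseSet → ℤ
δ F = + c F - + n F

nCommon : ClauseSet → ClauseSet → ℕ
nCommon F G = length (filter (λ v → v ∈ℕ? varList G) (varList F))

Meets : Clause → Clause → Set
Meets C D = ∃ λ x → x ∈ C × x ∈ D

Satisfiable : ClauseSet → Set
Satisfiable F = ∃ λ T → IsClause T × All (Meets T) F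

Clash : Clause → Clause → Set
Clash C D = ∃ λ x → x ∈ C × (- x) ∈ D

Hitting : ClauseSet → Set
Hitting F = AllPairs Clash F

ldeg : ClauseSet → Lit → ℕ
ldeg F x = length (filter (λ C → x ∈? C) F)

Singular : ClauseSet → ℕ → Set
Singular F v = v ∈ varList F × ℕ._⊓_ (ldeg F (+ v)) (ldeg F (- (+ v))) ≡ 1

Nonsingular : ClauseSet → Set
Nonsingular F = ∀ v → ¬ Singular F v

NUH : ClauseSet → Set
NUH F = IsClauseSet F × Nonsingular F × ¬ Satisfiable F × Hitting F

-- m is an upper bound of { n(F) : F nonsingular unsat hitting, δ(F) = k }.
-- "x ≤ N(k) + ..." is expressed as "x ≤ m + ... for every such upper bound m"
-- (which is exactly right for the supremum N(k) ∈ ℕ₀ ∪ {+∞}).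
NUpper : ℤ → ℕ → Set
NUpper k m = ∀ F → NUH F → δ F ≡ k → n F ≤ m

NIs : ℤ → ℕ → Set
NIs k m = NUpper k m × (∀ m' → NUpper k m' → m ≤ m')

InAll : ClauseSet → Lit → Set
InAll F x = All (x ∈_) F

reduct : ClauseSet → ClauseSet
reduct F = map (λ D → filter (λ x → ¬? (all? (λ E → x ∈? E) F)) D) F

IsClauseFactor : ClauseSet → Set
IsClauseFactor F' = (F' ≢ []) × ¬ Satisfiable (reduct F')

ClauseFactorOf : ClauseSet → ClauseSet → Set
ClauseFactorOf F' F = IsClauseSet F' × (F' ⊆cs F) × IsClauseFactor F'

TrivialFactor : ClauseSet → ClauseSet → Set
TrivialFactor F' F = (c F' ≡ 1) ⊎ (¬ Satisfiable F' × F' ≈cs F)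

ClauseReducible : ClauseSet → Set
ClauseReducible F = ∃ λ F' → ClauseFactorOf F' F × ¬ TrivialFactor F' F

NoClash : Clause → Clause → Set
NoClash C D = ∀ x → x ∈ C → - x ∉ D

LeftPart : ClauseSet → Clause → Clause → Set
LeftPart F0 C X = X ∈c F0 × ¬ (X ≈c C)

RightPart : Clause → ClauseSet → Clause → Set
RightPart C G X = ∃ λ D → D ∈ G × NoClash C D × X ≈c (C ++ D)

ClauseFactorisation : ClauseSet → ClauseSet → Clause → ClauseSet → Set
ClauseFactorisation F F0 C G =
  IsClauseSet F0 × IsClauseSet G × C ∈ F0 ×
  (∀ v → v ∈ varC C → v ∉ varList G) ×
  (∀ X → LeftPart F0 C X → ¬ RightPart C G X) ×
  ¬ Satisfiable G ×
  (∀ X → (X ∈c F) ⇔ (LeftPart F0 C X ⊎ RightPart C G X))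

IsBotSet : ClauseSet → Set
IsBotSet F = F ≈cs ([] ∷ [])

NontrivialFactorisation : ClauseSet → ClauseSet → Set
NontrivialFactorisation F0 G = ¬ IsBotSet F0 × ¬ IsBotSet G

FsResult : ClauseSet → Clause → Lit → Clause → Set
FsResult F E v X = X ≈c E ⊎ (X ∈c F × ¬ (X ≈c (v ∷ E)) × ¬ (X ≈c ((- v) ∷ E)))

StrictlyFsResolvable : ClauseSet → Set
StrictlyFsResolvable F = Σ Clause λ E → Σ Lit λ v →
  v ≢ + 0 × v ∉ E × (- v) ∉ E ×
  (v ∷ E) ∈c F × ((- v) ∷ E) ∈c F × ¬ (E ∈c F) ×
  (∀ w → (w ∈ varList F) ⇔ (∃ λ X → FsResult F E v X × w ∈ varC X))

{-# OPTIONS --safe #-}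
-- If a literal x occurs exactly once in an unsatisfiable hitting clause-set, in the
-- clause E say, then E minus x is contained in every clause containing the complement
-- of x. Hence eliminating var(x) is the same as setting x to true; it keeps the
-- deficiency, at most one literal of each clause has degree one, and new literals of
-- degree one only arise if the complement of x also occurs only once, i.e. from an
-- fs-pair. A strict fs-resolution thus makes at most three eliminations necessary
-- (var(v), one literal of E, and one more after a pair on v). Without strict
-- fs-resolution there is no such pair in F0 or G, and the degree-one literals of F0
-- and G belong to common variables, except for at most one literal of C.
--
-- Setting a variable of minimal degree loses no other variable. By induction this
-- gives c > n, and if c = n + 1 that variable occurs exactly once in each sign. This
-- excludes deficiency 1 for F0 and G in part (3b), and settles k = 2 in part (3a),
-- where the bound of part (1) is too weak.

module Submission where

open import Defs
open import Data.Nat using (ℕ; zero; suc; _≤_; _<_; _+_; _*_; _∸_; _⊓_; z≤n; s≤s)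
import Data.Nat as ℕ
import Data.Nat.Properties as ℕₚ
open import Data.Nat.Tactic.RingSolver using () renaming (solve-∀ to ℕ-solve-∀)
open import Data.Integer as ℤ using (ℤ; +_; -_; ∣_∣)
import Data.Integer.Properties as ℤₚ
open import Data.Integer.Tactic.RingSolver using (solve-∀)
open import Data.List using (List; []; _∷_; [_]; _++_; map; filter; length; concat)
import Data.List.Properties as Listₚ
open import Data.List.Relation.Unary.All as All using (All; []; _∷_; all?)
import Data.List.Relation.Unary.All.Properties as Allₚ
open import Data.List.Relation.Unary.Any as Any using (Any; here; there; any?; _─_)
import Data.List.Relation.Unary.Any.Properties as Anyₚ
open import Data.List.Relation.Unary.AllPairs as AllPairs using (AllPairs; []; _∷_)
import Data.List.Relation.Unary.AllPairs.Properties as AllPairsₚ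
open import Data.List.Relation.Unary.Unique.Propositional using (Unique)
open import Data.List.Relation.Unary.Unique.DecPropositional.Properties ℕ._≟_ using (deduplicate-!)
open import Data.List.Membership.Propositional using (_∈_; _∉_; find; lose)
open import Data.List.Membership.Propositional.Properties
open import Data.List.Relation.Binary.Subset.Propositional using (_⊆_)
import Data.List.Membership.DecPropositional as DecMem
open DecMem ℤ._≟_ using (_∈?_)
open DecMem ℕ._≟_ using () renaming (_∈?_ to _∈ℕ?_)
open import Data.Product using (∃; ∃₂; _×_; _,_; proj₁; proj₂; swap)
open import Data.Sum using (_⊎_; inj₁; inj₂; [_,_]′)
open import Data.Empty using (⊥-elim)
open import Function using (_∘_; id; case_of_)
open import Function.Bundles using (mk⇔; Equivalence)
open import Relation.Nullary using (¬_; Dec; yes; no; ¬?; contradiction)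
open import Relation.Nullary.Decidable using (_×-dec_; map′)
open import Relation.Unary using (Decidable)
open import Relation.Binary.PropositionalEquality hiding ([_])

-- Counting and searching in lists

module _ {A : Set} {R : A → A → Set} (R-sym : ∀ {x y} → R x y → R y x)
         (R-trans : ∀ {x y z} → R x y → R y z → R x z) where

  private
    ─-avoids : ∀ {x y} ys (p : Any (R x) ys) → ¬ R x y → Any (R y) ys → Any (R y) (ys ─ p)
    ─-avoids (_ ∷ _)  (here p)  ¬xy (here q)  = contradiction (R-trans p (R-sym q)) ¬xy
    ─-avoids (_ ∷ _)  (here p)  ¬xy (there q) = q
    ─-avoids (_ ∷ _)  (there p) ¬xy (here q)  = here q
    ─-avoids (_ ∷ ys) (there p) ¬xy (there q) = there (─-avoids ys p ¬xy q)

  -- Each entry of `xs` uses up the entry of `ys` matched to it. The later entries of `xs` are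
  -- inequivalent to it and so keep their matches among what is left.
  pigeonhole : ∀ {xs} ys → AllPairs (λ x y → ¬ R x y) xs →
               All (λ x → Any (R x) ys) xs → length xs ≤ length ys
  pigeonhole ys []         []       = z≤n
  pigeonhole {_ ∷ xs} ys (x≉ ∷ ds) (p ∷ ps) = begin
    suc (length xs)       ≤⟨ s≤s (pigeonhole (ys ─ p) ds
                               (All.zipWith (λ (¬xy , q) → ─-avoids ys p ¬xy q) (x≉ , ps))) ⟩
    suc (length (ys ─ p)) ≡⟨ Listₚ.length-removeAt′ ys _ ⟨
    length ys             ∎
    where open ℕₚ.≤-Reasoning

Unique-⊆-length : {xs ys : List ℕ} → Unique xs → xs ⊆ ys → length xs ≤ length ys
Unique-⊆-length {ys = ys} u s = pigeonhole sym trans ys u (All.tabulate s)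

AllPairs-map-∈ : ∀ {A : Set} {R S : A → A → Set} {xs} →
                 (∀ {x y} → x ∈ xs → y ∈ xs → R x y → S x y) → AllPairs R xs → AllPairs S xs
AllPairs-map-∈ f []       = []
AllPairs-map-∈ f (r ∷ rs) =
  All.tabulate (λ y∈ → f (here refl) (there y∈) (All.lookup r y∈)) ∷
  AllPairs-map-∈ (λ p q → f (there p) (there q)) rs

AllPairs-lookup : ∀ {A : Set} {R : A → A → Set} {xs} → (∀ {x y} → R x y → R y x) →
                  AllPairs R xs → ∀ {x y} → x ∈ xs → y ∈ xs → x ≡ y ⊎ R x y
AllPairs-lookup sy (r ∷ rs) (here refl) (here refl) = inj₁ refl
AllPairs-lookup sy (r ∷ rs) (here refl) (there q)   = inj₂ (All.lookup r q)
AllPairs-lookup sy (r ∷ rs) (there p)   (here refl) = inj₂ (sy (All.lookup r p))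
AllPairs-lookup sy (r ∷ rs) (there p)   (there q)   = AllPairs-lookup sy rs p q

length-filter-split : ∀ {A : Set} {P : A → Set} (P? : Decidable P) xs →
  length xs ≡ length (filter P? xs) + length (filter (¬? ∘ P?) xs)
length-filter-split P? [] = refl
length-filter-split P? (x ∷ xs) with P? x
... | yes _ = cong suc (length-filter-split P? xs)
... | no  _ = trans (cong suc (length-filter-split P? xs)) (sym (ℕₚ.+-suc _ _))

∃-minimiser : ∀ (f : ℕ → ℕ) xs → xs ≢ [] → ∃ λ v → v ∈ xs × (∀ {u} → u ∈ xs → f v ≤ f u)
∃-minimiser f []       ne = contradiction refl ne
∃-minimiser f (x ∷ []) ne = x , here refl , λ { (here refl) → ℕₚ.≤-refl }
∃-minimiser f (x ∷ xs@(_ ∷ _)) ne with ∃-minimiser f xs (λ ())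
... | v , v∈ , v≤ with ℕₚ.≤-total (f x) (f v)
...   | inj₁ x≤v = x , here refl , λ { (here refl) → ℕₚ.≤-refl ; (there u∈) → ℕₚ.≤-trans x≤v (v≤ u∈) }
...   | inj₂ v≤x = v , there v∈ , λ { (here refl) → v≤x ; (there u∈) → v≤ u∈ }

-- Literals, complements and clauses as sets

∣∣-cases : ∀ {x y : ℤ} → ∣ x ∣ ≡ ∣ y ∣ → x ≡ y ⊎ x ≡ - y
∣∣-cases {x} {y} eq with ℤₚ.+∣i∣≡i⊎+∣i∣≡-i x | ℤₚ.+∣i∣≡i⊎+∣i∣≡-i y
... | inj₁ p | inj₁ q = inj₁ (trans (sym p) (trans (cong +_ eq) q))
... | inj₁ p | inj₂ q = inj₂ (trans (sym p) (trans (cong +_ eq) q))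
... | inj₂ p | inj₁ q = inj₂ (trans (sym (ℤₚ.neg-involutive x)) (cong -_ (trans (sym p) (trans (cong +_ eq) q))))
... | inj₂ p | inj₂ q = inj₁ (ℤₚ.neg-injective (trans (sym p) (trans (cong +_ eq) q)))

x≢-x : ∀ {x} → x ≢ + 0 → x ≢ - x
x≢-x {+ 0}          x≢0 _ = x≢0 refl
x≢-x {+ (suc _)}    x≢0 ()
x≢-x {ℤ.-[1+ _ ]}   x≢0 ()

neg-swap : ∀ {x y : ℤ} → - x ≡ y → x ≡ - y
neg-swap {x} eq = trans (sym (ℤₚ.neg-involutive x)) (cong -_ eq)

neg-≢0 : ∀ {x} → x ≢ + 0 → - x ≢ + 0
neg-≢0 x≢0 eq = x≢0 (neg-swap eq)

neg∈-neg : ∀ {x D} → x ∈ D → - (- x) ∈ D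
neg∈-neg {x} {D} = subst (_∈ D) (sym (ℤₚ.neg-involutive x))

≈c-refl : ∀ {C} → C ≈c C
≈c-refl = id , id

≈c-sym : ∀ {C D} → C ≈c D → D ≈c C
≈c-sym = swap

≈c-trans : ∀ {C D E} → C ≈c D → D ≈c E → C ≈c E
≈c-trans (p , p′) (q , q′) = q ∘ p , p′ ∘ q′

_⊆?_ : ∀ C D → Dec (C ⊆ D)
C ⊆? D = map′ All.lookup All.tabulate (all? (_∈? D) C)

_≈c?_ : ∀ C D → Dec (C ≈c D)
C ≈c? D = (C ⊆? D) ×-dec (D ⊆? C)

IsClause-≢0 : ∀ {C x} → IsClause C → x ∈ C → x ≢ + 0
IsClause-≢0 (nz , _) x∈ = All.lookup nz x∈

IsClause-⊆ : ∀ {C D} → C ⊆ D → IsClause D → IsClause C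
IsClause-⊆ s (nz , nc) = All.tabulate (λ x∈ → All.lookup nz (s x∈)) , λ x x∈ -x∈ → nc x (s x∈) (s -x∈)

Clash-sym : ∀ {C D} → Clash C D → Clash D C
Clash-sym (x , x∈ , -x∈) = - x , -x∈ , neg∈-neg x∈

Clash-resp : ∀ {C D C′ D′} → C ⊆ C′ → D ⊆ D′ → Clash C D → Clash C′ D′
Clash-resp s t (x , x∈ , -x∈) = x , s x∈ , t -x∈

Clash⇒≉ : ∀ {C D} → IsClause C → Clash C D → ¬ C ≈c D
Clash⇒≉ (_ , nc) (x , x∈ , -x∈) (_ , s) = nc x x∈ (s -x∈)

∈⇒∈c : ∀ {C F} → C ∈ F → C ∈c F
∈⇒∈c C∈ = lose C∈ ≈c-refl

∈c-resp : ∀ {C D F} → C ≈c D → C ∈c F → D ∈c F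
∈c-resp C≈D = Any.map (≈c-trans (≈c-sym C≈D))

remove : Lit → Clause → Clause
remove x = filter (λ y → ¬? (y ℤ.≟ x))

∈-remove⁺ : ∀ {x y D} → y ∈ D → y ≢ x → y ∈ remove x D
∈-remove⁺ = ∈-filter⁺ _

∈-remove⁻ : ∀ {x y D} → y ∈ remove x D → y ∈ D × y ≢ x
∈-remove⁻ {x} {y} {D} = ∈-filter⁻ (λ y → ¬? (y ℤ.≟ x)) {xs = D}

remove-⊆ : ∀ {x} D → remove x D ⊆ D
remove-⊆ D = proj₁ ∘ ∈-remove⁻ {D = D}

-- Variables and literal degrees

∈-varList⁺ : ∀ {F D x} → D ∈ F → x ∈ D → ∣ x ∣ ∈ varList F
∈-varList⁺ D∈ x∈ = ∈-deduplicate⁺ ℕ._≟_ (∈-map⁺ ∣_∣ (∈-concat⁺′ x∈ D∈))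

∈-varList⁻ : ∀ {F w} → w ∈ varList F → ∃₂ λ D x → D ∈ F × x ∈ D × w ≡ ∣ x ∣
∈-varList⁻ {F} w∈ with ∈-map⁻ ∣_∣ (∈-deduplicate⁻ ℕ._≟_ (map ∣_∣ (concat F)) w∈)
... | x , x∈ , eq with ∈-concat⁻′ F x∈
...   | D , x∈D , D∈ = D , x , D∈ , x∈D , eq

∈c-varList : ∀ {F X x} → X ∈c F → x ∈ X → ∣ x ∣ ∈ varList F
∈c-varList X∈ x∈ with find X∈
... | X₁ , X₁∈ , X≈ = ∈-varList⁺ X₁∈ (proj₁ X≈ x∈)

varList-unique : ∀ F → Unique (varList F)
varList-unique F = deduplicate-! (map ∣_∣ (concat F))

n-mono : ∀ {F G} → varList F ⊆ varList G → n F ≤ n G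
n-mono {F} = Unique-⊆-length (varList-unique F)

varList-⊆cs : ∀ {F G} → F ⊆cs G → varList F ⊆ varList G
varList-⊆cs {F} F⊆G w∈ with ∈-varList⁻ {F} w∈
... | D , x , D∈ , x∈ , refl = ∈c-varList (All.lookup F⊆G D∈) x∈

ldeg-∷-∈ : ∀ {y D} F → y ∈ D → ldeg (D ∷ F) y ≡ suc (ldeg F y)
ldeg-∷-∈ {y} F y∈ = cong length (Listₚ.filter-accept (y ∈?_) {xs = F} y∈)

ldeg-∷-∉ : ∀ {y D} F → y ∉ D → ldeg (D ∷ F) y ≡ ldeg F y
ldeg-∷-∉ {y} F y∉ = cong length (Listₚ.filter-reject (y ∈?_) {xs = F} y∉)

ldeg-++ : ∀ F G y → ldeg (F ++ G) y ≡ ldeg F y + ldeg G y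
ldeg-++ F G y = trans (cong length (Listₚ.filter-++ (y ∈?_) F G)) (Listₚ.length-++ (filter (y ∈?_) F))

ldeg-mono : ∀ {x y} F → (∀ {D} → D ∈ F → x ∈ D → y ∈ D) → ldeg F x ≤ ldeg F y
ldeg-mono [] f = z≤n
ldeg-mono {x} {y} (D ∷ F) f with x ∈? D | y ∈? D
... | yes x∈ | yes y∈ = s≤s (ldeg-mono F (f ∘ there))
... | yes x∈ | no y∉  = contradiction (f (here refl) x∈) y∉
... | no x∉  | yes y∈ = ℕₚ.m≤n⇒m≤1+n (ldeg-mono F (f ∘ there))
... | no x∉  | no y∉  = ldeg-mono F (f ∘ there)

ldeg-map : ∀ {y} (f : Clause → Clause) F → (∀ {D} → (y ∈ D → y ∈ f D) × (y ∈ f D → y ∈ D)) →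
           ldeg (map f F) y ≡ ldeg F y
ldeg-map f [] h = refl
ldeg-map {y} f (D ∷ F) h with y ∈? D | y ∈? f D
... | yes _ | yes _ = cong suc (ldeg-map f F h)
... | yes p | no q  = contradiction (proj₁ h p) q
... | no p  | yes q = contradiction (proj₂ h q) p
... | no _  | no _  = ldeg-map f F h

ldeg-split : ∀ {P : Clause → Set} (P? : Decidable P) F y →
             ldeg F y ≡ ldeg (filter P? F) y + ldeg (filter (¬? ∘ P?) F) y
ldeg-split P? [] y = refl
ldeg-split P? (D ∷ F) y with P? D
... | yes _ with y ∈? D
...   | yes _ = cong suc (ldeg-split P? F y)
...   | no  _ = ldeg-split P? F y
ldeg-split P? (D ∷ F) y | no _ with y ∈? D
...   | yes _ = trans (cong suc (ldeg-split P? F y)) (sym (ℕₚ.+-suc _ _))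
...   | no  _ = ldeg-split P? F y

ldeg>0 : ∀ {F D y} → D ∈ F → y ∈ D → 0 < ldeg F y
ldeg>0 {y = y} D∈ y∈ = Listₚ.filter-some (y ∈?_) (lose D∈ y∈)

ldeg≡0 : ∀ {F y} → ∣ y ∣ ∉ varList F → ldeg F y ≡ 0
ldeg≡0 {F} {y} y∉ = cong length (Listₚ.filter-none (y ∈?_) {F} (All.tabulate λ D∈ y∈ → y∉ (∈-varList⁺ D∈ y∈)))

ldeg>0⁻ : ∀ {F y} → 0 < ldeg F y → ∃ λ D → D ∈ F × y ∈ D
ldeg>0⁻ {F} {y} pos with any? (y ∈?_) F
... | yes p = find p
... | no ¬p = contradiction (subst (0 <_) (cong length (Listₚ.filter-none (y ∈?_) (Allₚ.¬Any⇒All¬ F ¬p))) pos) λ ()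

ldeg≡1-occurs : ∀ {F y} → ldeg F y ≡ 1 → ∃ λ D → D ∈ F × y ∈ D
ldeg≡1-occurs {F} {y} eq = ldeg>0⁻ {F} {y} (subst (0 <_) (sym eq) (s≤s z≤n))

ldeg≡1-filter : ∀ {F y H} → ldeg F y ≡ 1 → H ∈ F → y ∈ H → filter (y ∈?_) F ≡ [ H ]
ldeg≡1-filter {F} {y} eq H∈ y∈ with filter (y ∈?_) F | ∈-filter⁺ (y ∈?_) H∈ y∈
... | D ∷ [] | here refl = refl
ldeg≡1-filter {F} {y} () H∈ y∈ | _ ∷ _ ∷ _ | _

ldeg≡1-unique : ∀ {F y H X} → ldeg F y ≡ 1 → H ∈ F → y ∈ H → X ∈ F → y ∈ X → X ≡ H
ldeg≡1-unique {F} {y} eq H∈ y∈H X∈ y∈X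
  with subst (_ ∈_) (ldeg≡1-filter eq H∈ y∈H) (∈-filter⁺ (y ∈?_) X∈ y∈X)
... | here X≡H = X≡H

-- Unsatisfiable hitting clause-sets

record UHIT (F : ClauseSet) : Set where
  constructor uhit
  field
    clauses : ∀ {D} → D ∈ F → IsClause D
    unsat   : ¬ Satisfiable F
    hitting : Hitting F

  hits : ∀ {C D} → C ∈ F → D ∈ F → C ≡ D ⊎ Clash C D
  hits = AllPairs-lookup Clash-sym hitting

  distinct : AllPairs (λ C D → ¬ C ≈c D) F
  distinct = AllPairs-map-∈ (λ C∈ _ → Clash⇒≉ (clauses C∈)) hitting

open UHIT

-- The assignment falsifying D satisfies all other clauses; flipping l in it
-- (and setting z to true) must therefore falsify some clause X.
flip-literal : ∀ {F D l z} → UHIT F → D ∈ F → l ∈ D →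
               z ≢ + 0 → z ≢ - l → (z ∈ D → z ≡ l) →
               ∃ λ X → X ∈ F × - l ∈ X × z ∉ X
flip-literal {F} {D} {l} {z} U D∈ l∈ z≢0 z≢-l z∈D⇒z≡l
  with any? (λ X → (- l ∈? X) ×-dec ¬? (z ∈? X)) F
... | yes p = find p
... | no ¬p = ⊥-elim (unsat U (T , (T-≢0 , T-consistent) , All.tabulate T-meets))
  where
  T : Clause
  T = l ∷ z ∷ map -_ (remove l D)

  T-elim : ∀ {a} → a ∈ T → a ≡ l ⊎ a ≡ z ⊎ (- a ∈ D × - a ≢ l)
  T-elim (here a≡l) = inj₁ a≡l
  T-elim (there (here a≡z)) = inj₂ (inj₁ a≡z)
  T-elim (there (there a∈)) with ∈-map⁻ -_ a∈
  ... | d , d∈ , refl rewrite ℤₚ.neg-involutive d = inj₂ (inj₂ (∈-remove⁻ {D = D} d∈))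

  l≢0 : l ≢ + 0
  l≢0 = IsClause-≢0 (clauses U D∈) l∈

  T-≢0 : All (_≢ + 0) T
  T-≢0 = l≢0 ∷ z≢0 ∷ Allₚ.map⁺ (All.tabulate λ d∈ → neg-≢0 (IsClause-≢0 (clauses U D∈) (remove-⊆ D d∈)))

  T-consistent : ∀ a → a ∈ T → - a ∉ T
  T-consistent a a∈ -a∈ with T-elim a∈ | T-elim -a∈
  ... | inj₁ refl | inj₁ q = x≢-x l≢0 (sym q)
  ... | inj₁ refl | inj₂ (inj₁ q) = z≢-l (sym q)
  ... | inj₁ refl | inj₂ (inj₂ (_ , q)) = q (ℤₚ.neg-involutive a)
  ... | inj₂ (inj₁ refl) | inj₁ q = z≢-l (neg-swap q)
  ... | inj₂ (inj₁ refl) | inj₂ (inj₁ q) = x≢-x z≢0 (sym q)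
  ... | inj₂ (inj₁ refl) | inj₂ (inj₂ (p , q)) rewrite ℤₚ.neg-involutive a = q (z∈D⇒z≡l p)
  ... | inj₂ (inj₂ (_ , p)) | inj₁ q = p q
  ... | inj₂ (inj₂ (p , p′)) | inj₂ (inj₁ refl) = p′ (z∈D⇒z≡l p)
  ... | inj₂ (inj₂ (p , _)) | inj₂ (inj₂ (q , _)) = proj₂ (clauses U D∈) (- a) p q

  T-meets : ∀ {X} → X ∈ F → Meets T X
  T-meets {X} X∈ with hits U D∈ X∈
  ... | inj₁ refl = l , here refl , l∈
  ... | inj₂ (x , x∈ , -x∈) with x ℤ.≟ l
  ...   | no x≢l = - x , there (there (∈-map⁺ -_ (∈-remove⁺ x∈ x≢l))) , -x∈
  ...   | yes refl with z ∈? X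
  ...     | yes z∈ = z , there (here refl) , z∈
  ...     | no z∉ = contradiction (lose X∈ (-x∈ , z∉)) ¬p

complement-occurs : ∀ {F D l} → UHIT F → D ∈ F → l ∈ D → ∃ λ X → X ∈ F × - l ∈ X
-- The choice `z = l` makes the condition on `z` trivial, so only the flip of `l` is used.
complement-occurs U D∈ l∈ with flip-literal U D∈ l∈ l≢0 (x≢-x l≢0) (λ _ → refl)
  where l≢0 = IsClause-≢0 (clauses U D∈) l∈
... | X , X∈ , -l∈ , _ = X , X∈ , -l∈

complement-ldeg>0 : ∀ {F l} → UHIT F → 0 < ldeg F l → 0 < ldeg F (- l)
complement-ldeg>0 {F} {l} U pos with ldeg>0⁻ {F} {l} pos
... | D , D∈ , l∈ with complement-occurs U D∈ l∈
...   | X , X∈ , -l∈ = ldeg>0 X∈ -l∈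

-- If `z` were missing from `D`, flipping `- y` in `D` and setting `z` to true would produce a
-- clause that contains `y` but not `z`. The only clause containing `y` is `E`, which contains `z`.
main-⊆-side : ∀ {F y z E D} → UHIT F → ldeg F y ≡ 1 → E ∈ F → y ∈ E → D ∈ F → - y ∈ D →
              z ∈ E → z ≢ y → z ∈ D
main-⊆-side {F} {y} {z} {E} {D} U deg E∈ y∈ D∈ -y∈ z∈ z≢y with z ∈? D
... | yes z∈D = z∈D
... | no z∉D with flip-literal U D∈ -y∈ (IsClause-≢0 (clauses U E∈) z∈)
                   (λ eq → z≢y (trans eq (ℤₚ.neg-involutive y))) (λ z∈D → contradiction z∈D z∉D)
...   | X , X∈ , y∈X , z∉X = contradiction
        (subst (z ∈_) (sym (ldeg≡1-unique {F} deg E∈ y∈ X∈ (subst (_∈ X) (ℤₚ.neg-involutive y) y∈X))) z∈) z∉X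

-- Otherwise `z` lies in a clause containing `- y` as well. By its degree that clause is `E`, which
-- would then contain both `y` and `- y`.
main-literal-unique : ∀ {F y z E} → UHIT F → E ∈ F → y ∈ E → z ∈ E →
                      ldeg F y ≡ 1 → ldeg F z ≡ 1 → y ≡ z
main-literal-unique {F} {y} {z} {E} U E∈ y∈ z∈ dy dz with z ℤ.≟ y
... | yes z≡y = sym z≡y
... | no z≢y with complement-occurs U E∈ y∈
...   | D , D∈ , -y∈ with ldeg≡1-unique {F} dz E∈ z∈ D∈ (main-⊆-side U dy E∈ y∈ D∈ -y∈ z∈ z≢y)
...     | refl = contradiction -y∈ (proj₂ (clauses U E∈) y y∈)

-- The clause-set F⟨x → 1⟩. When x occurs only once, this is DP-elimination of
-- its variable, since the main clause minus x is contained in every side clause.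
opaque
  assign : Lit → ClauseSet → ClauseSet
  assign x F = map (remove (- x)) (filter (λ D → ¬? (x ∈? D)) F)

  ∈-assign⁺ : ∀ {x F D} → D ∈ F → x ∉ D → remove (- x) D ∈ assign x F
  ∈-assign⁺ D∈ x∉ = ∈-map⁺ _ (∈-filter⁺ _ D∈ x∉)

  ∈-assign⁻ : ∀ {x F X} → X ∈ assign x F → ∃ λ D → D ∈ F × x ∉ D × X ≡ remove (- x) D
  ∈-assign⁻ {x} {F} X∈ with ∈-map⁻ (remove (- x)) X∈
  ... | D , D∈′ , eq with ∈-filter⁻ (λ D → ¬? (x ∈? D)) {xs = F} D∈′
  ...   | D∈ , x∉ = D , D∈ , x∉ , eq

  -- The remaining clauses lack `x`, so no clash between two of them uses its variable, and each
  -- survives the removal of `- x`. An assignment satisfying the result extends by `x` to one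
  -- satisfying `F`.
  assign-uhit : ∀ {x F} → x ≢ + 0 → UHIT F → UHIT (assign x F)
  assign-uhit {x} {F} x≢0 U = uhit cl us hit
    where
    cl : ∀ {D} → D ∈ assign x F → IsClause D
    cl X∈ with ∈-assign⁻ {x} {F} X∈
    ... | D , D∈ , _ , refl = IsClause-⊆ (remove-⊆ D) (clauses U D∈)

    us : ¬ Satisfiable (assign x F)
    us (T , Tc , meets) = unsat U
      ( x ∷ remove (- x) T
      , (x≢0 ∷ proj₁ (IsClause-⊆ (remove-⊆ T) Tc) , consistent)
      , All.tabulate meets′ )
      where
      consistent : ∀ a → a ∈ x ∷ remove (- x) T → - a ∉ x ∷ remove (- x) T
      consistent a (here refl) (here q)  = x≢-x x≢0 (sym q)
      consistent a (here refl) (there q) = proj₂ (∈-remove⁻ {D = T} q) refl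
      consistent a (there p)   (here q)  = proj₂ (∈-remove⁻ {D = T} p) (neg-swap q)
      consistent a (there p)   (there q) = proj₂ Tc a (remove-⊆ T p) (remove-⊆ T q)

      meets′ : ∀ {D} → D ∈ F → Meets (x ∷ remove (- x) T) D
      meets′ {D} D∈ with x ∈? D
      ... | yes x∈ = x , here refl , x∈
      ... | no x∉ with All.lookup meets (∈-assign⁺ D∈ x∉)
      ...   | w , w∈T , w∈ with ∈-remove⁻ {D = D} w∈
      ...     | w∈D , w≢ = w , there (∈-remove⁺ w∈T w≢) , w∈D

    hit : Hitting (assign x F)
    hit = AllPairsₚ.map⁺ (AllPairs-map-∈ keep (AllPairsₚ.filter⁺ _ (hitting U)))
      where
      keep : ∀ {C D} → C ∈ filter (λ D → ¬? (x ∈? D)) F → D ∈ filter (λ D → ¬? (x ∈? D)) F →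
             Clash C D → Clash (remove (- x) C) (remove (- x) D)
      keep C∈ D∈ (a , a∈ , -a∈) = a ,
        ∈-remove⁺ a∈ (λ { refl → proj₂ (∈-filter⁻ _ {xs = F} D∈) (subst (_∈ _) (ℤₚ.neg-involutive x) -a∈) }) ,
        ∈-remove⁺ -a∈ (λ eq → proj₂ (∈-filter⁻ _ {xs = F} C∈) (subst (_∈ _) (ℤₚ.neg-injective eq) a∈))

  c-assign : ∀ x F → c F ≡ ldeg F x + c (assign x F)
  c-assign x F = trans (length-filter-split (x ∈?_) F)
                       (cong (λ k → ldeg F x + k) (sym (Listₚ.length-map _ (filter (λ D → ¬? (x ∈? D)) F))))

  ldeg-assign-filter : ∀ {x z} F → z ≢ - x → ldeg (assign x F) z ≡ ldeg (filter (λ D → ¬? (x ∈? D)) F) z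
  ldeg-assign-filter {x} F z≢-x = ldeg-map (remove (- x)) (filter (λ D → ¬? (x ∈? D)) F)
    (λ {D} → (λ z∈ → ∈-remove⁺ z∈ z≢-x) , remove-⊆ D)

ldeg-assign : ∀ {x z} F → z ≢ - x → ldeg F z ≡ ldeg (filter (x ∈?_) F) z + ldeg (assign x F) z
ldeg-assign {x} {z} F z≢-x = trans (ldeg-split (x ∈?_) F z)
  (cong (λ k → ldeg (filter (x ∈?_) F) z + k) (sym (ldeg-assign-filter F z≢-x)))

varList-assign : ∀ {x F w} → w ∈ varList (assign x F) → w ∈ varList F × w ≢ ∣ x ∣
varList-assign {x} {F} w∈ with ∈-varList⁻ {assign x F} w∈
... | X , a , X∈ , a∈ , refl with ∈-assign⁻ {x} {F} X∈
...   | D , D∈ , x∉ , refl with ∈-remove⁻ {D = D} a∈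
...     | a∈D , a≢ = ∈-varList⁺ D∈ a∈D ,
          λ eq → [ (λ { refl → x∉ a∈D }) , a≢ ]′ (∣∣-cases {a} {x} eq)

n-assign : ∀ {x F} → ∣ x ∣ ∈ varList F →
           (∀ {w} → w ∈ varList F → w ≢ ∣ x ∣ → w ∈ varList (assign x F)) →
           n F ≡ suc (n (assign x F))
n-assign {x} {F} x∈ keep = ℕₚ.≤-antisym
  (Unique-⊆-length (varList-unique F) split)
  (Unique-⊆-length (All.tabulate (λ w∈ eq → proj₂ (varList-assign {x} {F} w∈) (sym eq)) ∷ varList-unique (assign x F))
     λ { (here refl) → x∈ ; (there w∈) → proj₁ (varList-assign {x} {F} w∈) })
  where
  split : varList F ⊆ ∣ x ∣ ∷ varList (assign x F)
  split {w} w∈ with w ℕ.≟ ∣ x ∣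
  ... | yes eq = here eq
  ... | no ≢ = there (keep w∈ ≢)

-- Variables of minimal degree

deg : ClauseSet → Lit → ℕ
deg F x = ldeg F x + ldeg F (- x)

deg-abs : ∀ F x → deg F (+ ∣ x ∣) ≡ deg F x
deg-abs F x with ℤₚ.+∣i∣≡i⊎+∣i∣≡-i x
... | inj₁ eq = cong (deg F) eq
... | inj₂ eq = trans (cong (deg F) eq)
                 (trans (ℕₚ.+-comm (ldeg F (- x)) _) (cong (λ a → ldeg F a + ldeg F (- x)) (ℤₚ.neg-involutive x)))

deg≤c : ∀ {z} F → (∀ {D} → D ∈ F → z ∈ D → - z ∉ D) → deg F z ≤ c F
deg≤c [] h = z≤n
deg≤c {z} (D ∷ F) h with z ∈? D | - z ∈? D
... | yes p | yes q = contradiction q (h (here refl) p)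
... | yes p | no q  = s≤s (deg≤c F (h ∘ there))
... | no p  | yes q = subst (_≤ suc (c F)) (sym (ℕₚ.+-suc (ldeg F z) _)) (s≤s (deg≤c F (h ∘ there)))
... | no p  | no q  = ℕₚ.m≤n⇒m≤1+n (deg≤c F (h ∘ there))

occurring-ldeg>0 : ∀ {F x} → UHIT F → ∣ x ∣ ∈ varList F → 0 < ldeg F x
occurring-ldeg>0 {F} {x} U x∈ with ∈-varList⁻ {F} x∈
... | D , a , D∈ , a∈ , eq with ∣∣-cases {x} {a} eq
...   | inj₁ refl = ldeg>0 D∈ a∈
...   | inj₂ refl = complement-ldeg>0 U (ldeg>0 D∈ a∈)

occurring-≢0 : ∀ {F x} → UHIT F → ∣ x ∣ ∈ varList F → x ≢ + 0
occurring-≢0 {F} {x} U x∈ refl with ldeg>0⁻ {F} {x} (occurring-ldeg>0 {F} {x} U x∈)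
... | D , D∈ , 0∈ = IsClause-≢0 (clauses U D∈) 0∈ refl

-- If u vanished when assigning ±v, all its occurrences would be in clauses
-- containing that literal, so u would have smaller degree than v.
∃-lossless-variable : ∀ {F} → UHIT F → n F ≢ 0 →
  ∃ λ v → v ∈ varList F × (∀ x → ∣ x ∣ ≡ v → n F ≡ suc (n (assign x F)))
∃-lossless-variable {F} U n≢0
  with ∃-minimiser (λ w → deg F (+ w)) (varList F) (λ eq → n≢0 (cong length eq))
... | v , v∈ , v-min = v , v∈ , λ { x refl → n-assign {x} {F} v∈ (keep x v∈ v-min) }
  where
  keep : ∀ x → ∣ x ∣ ∈ varList F → (∀ {u} → u ∈ varList F → deg F (+ ∣ x ∣) ≤ deg F (+ u)) →
         ∀ {w} → w ∈ varList F → w ≢ ∣ x ∣ → w ∈ varList (assign x F)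
  keep x x∈ x-min {w} w∈ w≢ with w ∈ℕ? varList (assign x F)
  ... | yes w∈′ = w∈′
  ... | no w∉ = contradiction (ℕₚ.≤-<-trans (x-min w∈) deg-w<) (ℕₚ.<-irrefl refl)
    where
    Q : ClauseSet
    Q = filter (x ∈?_) F

    ldeg-Q : ∀ a → ∣ a ∣ ≡ w → ldeg F a ≡ ldeg Q a
    ldeg-Q a refl = trans (ldeg-assign F (λ { refl → w≢ (ℤₚ.∣-i∣≡∣i∣ x) }))
      (trans (cong (λ k → ldeg Q a + k) (ldeg≡0 {assign x F} {a} w∉)) (ℕₚ.+-identityʳ _))

    deg-w< : deg F (+ w) < deg F (+ ∣ x ∣)
    deg-w< = begin-strict
      deg F (+ w)              ≡⟨ cong₂ _+_ (ldeg-Q (+ w) refl) (ldeg-Q (- (+ w)) (ℤₚ.∣-i∣≡∣i∣ (+ w))) ⟩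
      deg Q (+ w)              ≤⟨ deg≤c Q (λ D∈ → proj₂ (clauses U (proj₁ (∈-filter⁻ (x ∈?_) {xs = F} D∈))) (+ w)) ⟩
      -- The inequality is strict because the complement of `x` occurs too.
      ldeg F x                 <⟨ ℕₚ.m<m+n (ldeg F x) (complement-ldeg>0 {F} {x} U (occurring-ldeg>0 U x∈)) ⟩
      deg F x                  ≡⟨ deg-abs F x ⟨
      deg F (+ ∣ x ∣)          ∎
      where open ℕₚ.≤-Reasoning

-- Induction on the number of variables: setting a lossless variable removes exactly one variable
-- and at least one clause. Without variables, `F` is nonempty because the empty clause-set is
-- satisfiable.
n<c : ∀ {F} → UHIT F → n F < c F
n<c {F} = go (n F) refl
  where
  go : ∀ m {F} → n F ≡ m → UHIT F → m < c F
  go zero {[]} eq U = contradiction ([] , ([] , λ _ ()) , []) (unsat U)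
  go zero {_ ∷ _} eq U = s≤s z≤n
  go (suc m) {F} eq U with ∃-lossless-variable U (λ n≡0 → contradiction (trans (sym n≡0) eq) λ ())
  ... | v , v∈ , lossless = begin
    2 + m                               ≤⟨ ℕₚ.+-mono-≤ (occurring-ldeg>0 {F} {+ v} U v∈)
                                             (go m (ℕₚ.suc-injective (trans (sym (lossless (+ v) refl)) eq))
                                                   (assign-uhit (occurring-≢0 {x = + v} U v∈) U)) ⟩
    ldeg F (+ v) + c (assign (+ v) F)   ≡⟨ c-assign (+ v) F ⟨
    c F                                 ∎
    where open ℕₚ.≤-Reasoning

-- This is the equality case of `n<c`. Setting either literal of a lossless variable leaves a
-- clause-set still subject to `n<c`, so no more than one clause can have been removed.
∃-1-1-singular : ∀ {F} → UHIT F → n F ≢ 0 → c F ≡ suc (n F) → ∃ λ y → ldeg F y ≡ 1 × ldeg F (- y) ≡ 1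
∃-1-1-singular {F} U n≢0 c≡ with ∃-lossless-variable U n≢0
... | v , v∈ , lossless = + v , ldeg≡1 (+ v) refl , ldeg≡1 (- (+ v)) (ℤₚ.∣-i∣≡∣i∣ (+ v))
  where
  ldeg≡1 : ∀ x → ∣ x ∣ ≡ v → ldeg F x ≡ 1
  ldeg≡1 x refl = ℕₚ.≤-antisym (ℕₚ.+-cancelʳ-≤ (n F) _ _ le) (occurring-ldeg>0 U v∈)
    where
    open ℕₚ.≤-Reasoning
    le : ldeg F x + n F ≤ 1 + n F
    le = begin
      ldeg F x + n F                ≡⟨ cong (λ k → ldeg F x + k) (lossless x refl) ⟩
      ldeg F x + suc (n (assign x F)) ≤⟨ ℕₚ.+-monoʳ-≤ (ldeg F x) (n<c (assign-uhit (occurring-≢0 U v∈) U)) ⟩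
      ldeg F x + c (assign x F)     ≡⟨ c-assign x F ⟨
      c F                           ≡⟨ c≡ ⟩
      1 + n F                       ∎

-- Elimination of a variable one of whose literals occurs exactly once

-- Nonsingularity in terms of literals. In an unsatisfiable hitting clause-set the complement of an
-- occurring literal occurs, so a literal of degree one makes the minimum of the two degrees equal
-- to one.
NoDegreeOne : ClauseSet → Set
NoDegreeOne F = ∀ y → ldeg F y ≢ 1

ldeg≡1-∈var : ∀ {F y} → ldeg F y ≡ 1 → ∣ y ∣ ∈ varList F
ldeg≡1-∈var {F} {y} dy with ldeg≡1-occurs {F} {y} dy
... | D , D∈ , y∈ = ∈-varList⁺ D∈ y∈

ldeg≡1-complement : ∀ {F y} → UHIT F → ldeg F y ≡ 1 → 0 < ldeg F (- y)
ldeg≡1-complement {F} {y} U dy = complement-ldeg>0 U (subst (0 <_) (sym dy) (s≤s z≤n))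

nonsingular⇒noDegreeOne : ∀ {F} → UHIT F → Nonsingular F → NoDegreeOne F
nonsingular⇒noDegreeOne {F} U ns y dy = ns ∣ y ∣ (ldeg≡1-∈var {F} dy , min≡1)
  where
  min≡1 : ldeg F (+ ∣ y ∣) ⊓ ldeg F (- (+ ∣ y ∣)) ≡ 1
  min≡1 with ℤₚ.+∣i∣≡i⊎+∣i∣≡-i y
  ... | inj₁ eq rewrite eq | dy = ℕₚ.m≤n⇒m⊓n≡m (ldeg≡1-complement {F} {y} U dy)
  ... | inj₂ eq rewrite eq | ℤₚ.neg-involutive y | dy = ℕₚ.m≥n⇒m⊓n≡n (ldeg≡1-complement {F} {y} U dy)

noDegreeOne⇒nonsingular : ∀ {F} → NoDegreeOne F → Nonsingular F
noDegreeOne⇒nonsingular {F} nd v (_ , min≡1) with ℕₚ.⊓-sel (ldeg F (+ v)) (ldeg F (- (+ v)))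
... | inj₁ eq = nd (+ v) (trans (sym eq) min≡1)
... | inj₂ eq = nd (- (+ v)) (trans (sym eq) min≡1)

toNUH : ∀ {F} → UHIT F → NoDegreeOne F → NUH F
toNUH {F} U nd = (All.tabulate (clauses U) , distinct U) , noDegreeOne⇒nonsingular {F} nd , unsat U , hitting U

fromNUH : ∀ {F} → NUH F → UHIT F × NoDegreeOne F
fromNUH {F} ((cl , _) , ns , us , hit) = U , nonsingular⇒noDegreeOne U ns
  where
  U : UHIT F
  U = uhit (All.lookup cl) us hit

δ-suc : ∀ {F G} → c F ≡ suc (c G) → n F ≡ suc (n G) → δ G ≡ δ F
δ-suc {F} {G} cs ns rewrite cs | ns =
  trans (ℤₚ.m-n≡m⊖n (c G) (n G))
    (trans (sym (ℤₚ.[1+m]⊖[1+n]≡m⊖n (c G) (n G))) (sym (ℤₚ.m-n≡m⊖n (suc (c G)) (suc (n G)))))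

δ-pred : ∀ {F G} → c F ≡ suc (c G) → n F ≡ n G → δ G ≡ δ F ℤ.- + 1
δ-pred {F} {G} cs ns = trans (cancel-1 (+ c G) (+ n G))
  (sym (cong₂ (λ a b → + a ℤ.- + b ℤ.- + 1) cs ns))
  where
  cancel-1 : ∀ a b → a ℤ.- b ≡ + 1 ℤ.+ a ℤ.- b ℤ.- + 1
  cancel-1 = solve-∀

-- `H` is the main clause, the only one containing `y`; the side clauses are those containing `- y`.
-- Setting `y` to true deletes `H` and strips `- y` from the side clauses.
module Elimination {F : ClauseSet} {y : Lit} {H : Clause}
  (U : UHIT F) (H∈ : H ∈ F) (y∈ : y ∈ H) (dy : ldeg F y ≡ 1) where

  private
    y≢0 : y ≢ + 0
    y≢0 = IsClause-≢0 (clauses U H∈) y∈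

  result-uhit : UHIT (assign y F)
  result-uhit = assign-uhit y≢0 U

  side-clause : ∃ λ D → D ∈ F × - y ∈ D × y ∉ D
  side-clause with complement-occurs U H∈ y∈
  ... | D , D∈ , -y∈ = D , D∈ , -y∈ , λ y∈D → proj₂ (clauses U D∈) y y∈D -y∈

  -- The literals of the deleted clause other than `y` also lie in a side clause, so only the
  -- variable of `y` disappears.
  n-result : n F ≡ suc (n (assign y F))
  n-result = n-assign {y} {F} (∈-varList⁺ H∈ y∈) keep
    where
    keep : ∀ {w} → w ∈ varList F → w ≢ ∣ y ∣ → w ∈ varList (assign y F)
    keep w∈ w≢ with ∈-varList⁻ {F} w∈
    ... | D , z , D∈ , z∈ , refl with y ∈? D
    ...   | no y∉ = ∈-varList⁺ (∈-assign⁺ D∈ y∉) (∈-remove⁺ z∈ λ { refl → w≢ (ℤₚ.∣-i∣≡∣i∣ y) })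
    ...   | yes y∈D with side-clause
    ...     | K , K∈ , -y∈ , y∉K = ∈-varList⁺ (∈-assign⁺ K∈ y∉K)
              (∈-remove⁺ (main-⊆-side U dy D∈ y∈D K∈ -y∈ z∈ (λ { refl → w≢ refl }))
                         (λ { refl → w≢ (ℤₚ.∣-i∣≡∣i∣ y) }))

  c-result : c F ≡ suc (c (assign y F))
  c-result = trans (c-assign y F) (cong (_+ c (assign y F)) dy)

  δ-result : δ (assign y F) ≡ δ F
  δ-result = δ-suc {F} {assign y F} c-result n-result

  ldeg-∉main : ∀ {z} → z ∉ H → z ≢ - y → ldeg F z ≡ ldeg (assign y F) z
  ldeg-∉main {z} z∉ z≢ rewrite ldeg-assign F z≢ | ldeg≡1-filter {F} {y} dy H∈ y∈ =
    cong (_+ ldeg (assign y F) z) (ldeg-∷-∉ [] z∉)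

  result-degree-one-var : ∀ {z} → ldeg (assign y F) z ≡ 1 → ∣ z ∣ ≢ ∣ y ∣
  result-degree-one-var dz = proj₂ (varList-assign {y} {F} (ldeg≡1-∈var {assign y F} dz))

  result-degree-one-≢- : ∀ {z} → ldeg (assign y F) z ≡ 1 → z ≢ - y
  result-degree-one-≢- dz refl = result-degree-one-var dz (ℤₚ.∣-i∣≡∣i∣ y)

  -- Apart from the literals of the eliminated variable, a degree can change only through the
  -- deletion of `H`.
  changed-∈main : ∀ {z} → ldeg (assign y F) z ≡ 1 → ldeg F z ≢ 1 → z ∈ H
  changed-∈main {z} dz ¬dz with z ∈? H
  ... | yes z∈ = z∈
  ... | no z∉ = contradiction (trans (ldeg-∉main z∉ (result-degree-one-≢- dz)) dz) ¬dz

  -- A literal of the main clause survives in all the (at least two) side clauses.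
  no-new-degree-one : ldeg F (- y) ≢ 1 → ∀ {z} → ldeg (assign y F) z ≡ 1 → ldeg F z ≡ 1
  no-new-degree-one d-y≢1 {z} dz with z ∈? H
  ... | no z∉ = trans (ldeg-∉main z∉ (result-degree-one-≢- dz)) dz
  ... | yes z∈ = contradiction (ℕₚ.≤-antisym le (ldeg≡1-complement {F} {y} U dy)) d-y≢1
    where
    R : ClauseSet
    R = filter (λ D → ¬? (y ∈? D)) F
    open ℕₚ.≤-Reasoning
    le : ldeg F (- y) ≤ 1
    le = begin
      ldeg F (- y)                ≡⟨ ldeg-split (y ∈?_) F (- y) ⟩
      ldeg (filter (y ∈?_) F) (- y) + ldeg R (- y)
                                  ≡⟨ cong (λ Q → ldeg Q (- y) + ldeg R (- y)) (ldeg≡1-filter {F} dy H∈ y∈) ⟩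
      ldeg [ H ] (- y) + ldeg R (- y)
                                  ≡⟨ cong (_+ ldeg R (- y)) (ldeg-∷-∉ [] (proj₂ (clauses U H∈) y y∈)) ⟩
      ldeg R (- y)                ≤⟨ ldeg-mono R (λ D∈ -y∈ → main-⊆-side U dy H∈ y∈
                                       (proj₁ (∈-filter⁻ _ {xs = F} D∈)) -y∈ z∈
                                       (λ { refl → result-degree-one-var dz refl })) ⟩
      ldeg R z                    ≡⟨ ldeg-assign-filter F (result-degree-one-≢- dz) ⟨
      ldeg (assign y F) z         ≡⟨ dz ⟩
      1                           ∎

-- Reduction to a nonsingular clause-set of the same deficiency

record Reduction (F : ClauseSet) (k : ℕ) : Set where
  constructor reduction
  field
    result      : ClauseSet
    result-uhit : UHIT result
    result-ns   : NoDegreeOne result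
    δ-result    : δ result ≡ δ F
    n-bound     : n F ≤ n result + k

-- The nonsingular `result` has the deficiency of `F`, so it is among the clause-sets over which the
-- supremum is taken.
Reduction⇒bound : ∀ {F k m} → Reduction F k → NUpper (δ F) m → n F ≤ m + k
Reduction⇒bound {k = k} (reduction R U ns δ≡ b) upper = ℕₚ.≤-trans b (ℕₚ.+-monoˡ-≤ k (upper R (toNUH U ns) δ≡))

Reduction-step : ∀ {F G k} → δ G ≡ δ F → n F ≡ suc (n G) → Reduction G k → Reduction F (suc k)
Reduction-step {F} {G} {k} δ≡ n≡ (reduction R U ns δR b) = reduction R U ns (trans δR δ≡)
  (begin
    n F             ≡⟨ n≡ ⟩
    suc (n G)       ≤⟨ s≤s b ⟩
    suc (n R + k)   ≡⟨ ℕₚ.+-suc (n R) k ⟨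
    n R + suc k     ∎)
  where open ℕₚ.≤-Reasoning

Reduction-weaken : ∀ {F k l} → k ≤ l → Reduction F k → Reduction F l
Reduction-weaken k≤l (reduction R U ns δ≡ b) = reduction R U ns δ≡ (ℕₚ.≤-trans b (ℕₚ.+-monoʳ-≤ (n R) k≤l))

No-1-1-singular : ClauseSet → Set
No-1-1-singular F = ∀ y → ldeg F y ≡ 1 → ldeg F (- y) ≢ 1

degree-one? : ∀ F u → (∃ λ y → ∣ y ∣ ≡ u × ldeg F y ≡ 1) ⊎ (∀ y → ldeg F y ≡ 1 → ∣ y ∣ ≢ u)
degree-one? F u with ldeg F (+ u) ℕ.≟ 1 | ldeg F (- (+ u)) ℕ.≟ 1
... | yes du | _       = inj₁ (+ u , refl , du)
... | no _   | yes du  = inj₁ (- (+ u) , ℤₚ.∣-i∣≡∣i∣ (+ u) , du)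
... | no ¬du | no ¬du′ = inj₂ λ { y dy refl → case ℤₚ.+∣i∣≡i⊎+∣i∣≡-i y of λ
        { (inj₁ eq) → ¬du (trans (cong (ldeg F) eq) dy)
        ; (inj₂ eq) → ¬du′ (trans (cong (ldeg F) (trans (cong -_ eq) (ℤₚ.neg-involutive y))) dy) } }

-- `L` lists the variables that may need elimination. Since a literal and its complement never both
-- have degree one, an elimination creates no new degree-one literal, so the assumptions persist and
-- each entry of `L` costs at most one variable.
reduce : ∀ {F} (L : List ℕ) → UHIT F → No-1-1-singular F →
         (∀ {y} → ldeg F y ≡ 1 → ∣ y ∣ ∈ L) → Reduction F (length L)
reduce {F} [] U n11 cover = reduction F U (λ y dy → contradiction (cover {y} dy) λ ()) refl
                              (ℕₚ.≤-reflexive (sym (ℕₚ.+-identityʳ (n F))))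
reduce {F} (u ∷ L) U n11 cover with degree-one? F u
... | inj₂ ≢u = Reduction-weaken (ℕₚ.n≤1+n _) (reduce L U n11 λ {y} dy → Any.tail (≢u y dy) (cover {y} dy))
... | inj₁ (y , refl , dy) with ldeg≡1-occurs {F} {y} dy
...   | H , H∈ , y∈ = Reduction-step E.δ-result E.n-result
        (reduce L E.result-uhit (λ z dz d-z → n11 z (old dz) (old d-z))
           λ {z} dz → Any.tail (E.result-degree-one-var dz) (cover {z} (old dz)))
  where
  module E = Elimination U H∈ y∈ dy
  old : ∀ {z} → ldeg (assign y F) z ≡ 1 → ldeg F z ≡ 1
  old = E.no-new-degree-one (n11 y dy)

-- `K` contains no complementary literals, which excludes a variable with both degrees one. By
-- `main-literal-unique` at most one literal of `K` has degree one.
reduce-within-clause : ∀ {F K} → UHIT F → K ∈ F → (∀ {z} → ldeg F z ≡ 1 → z ∈ K) → Reduction F 1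
reduce-within-clause {F} {K} U K∈ inK = cases (any? (λ z → ldeg F z ℕ.≟ 1) K)
  where
  n11 : No-1-1-singular F
  n11 z dz d-z = proj₂ (clauses U K∈) z (inK dz) (inK d-z)

  cases : Dec (Any (λ z → ldeg F z ≡ 1) K) → Reduction F 1
  cases (no none) = Reduction-weaken z≤n (reduce [] U n11 λ {y} dy → contradiction (lose (inK {y} dy) dy) none)
  cases (yes some) with find some
  ... | x , x∈ , dx = reduce (∣ x ∣ ∷ []) U n11
        λ {y} dy → here (cong ∣_∣ (main-literal-unique U K∈ (inK {y} dy) x∈ dy dx))

-- If just one literal of the variable has degree one, a single elimination suffices. If both do,
-- the degree-one literals arising from the elimination lie in the main clause, hence in the
-- shortened side clause, and one further elimination suffices.
reduce-at-variable : ∀ {F v} → UHIT F → (∀ {y} → ldeg F y ≡ 1 → ∣ y ∣ ≡ v) → Reduction F 2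
reduce-at-variable {F} {v} U at-v with degree-one? F v
... | inj₂ ≢v = Reduction-weaken z≤n (reduce [] U (λ y dy → contradiction (at-v {y} dy) (≢v y dy))
                                               λ {y} dy → contradiction (at-v {y} dy) (≢v y dy))
... | inj₁ (y , refl , dy) with ldeg F (- y) ℕ.≟ 1
...   | no ¬d-y = Reduction-weaken (s≤s z≤n) (reduce (∣ y ∣ ∷ []) U n11 λ {z} dz → here (at-v {z} dz))
  where
  n11 : No-1-1-singular F
  n11 z dz d-z with ∣∣-cases {z} {y} (at-v {z} dz)
  ... | inj₁ refl = ¬d-y d-z
  ... | inj₂ refl = ¬d-y dz
...   | yes d-y with ldeg≡1-occurs {F} {y} dy
...     | H , H∈ , y∈ with Elimination.side-clause U H∈ y∈ dy
...       | K , K∈ , -y∈ , y∉K = Reduction-step E.δ-result E.n-result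
            (reduce-within-clause E.result-uhit (∈-assign⁺ K∈ y∉K) inK)
  where
  module E = Elimination U H∈ y∈ dy
  inK : ∀ {z} → ldeg (assign y F) z ≡ 1 → z ∈ remove (- y) K
  inK {z} dz = ∈-remove⁺ (main-⊆-side U dy H∈ y∈ K∈ -y∈ z∈H (λ { refl → ∣z∣≢ refl })) (E.result-degree-one-≢- dz)
    where
    ∣z∣≢ : ∣ z ∣ ≢ ∣ y ∣
    ∣z∣≢ = E.result-degree-one-var dz
    z∈H : z ∈ H
    z∈H = E.changed-∈main dz (λ dz′ → ∣z∣≢ (at-v dz′))

-- Equality of clause-sets given by lists without repetitions

record _≅_ (F G : ClauseSet) : Set where
  constructor equal
  field
    ⊆cs-fwd    : F ⊆cs G
    ⊆cs-bwd    : G ⊆cs F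
    distinct-l : AllPairs (λ C D → ¬ C ≈c D) F
    distinct-r : AllPairs (λ C D → ¬ C ≈c D) G

open _≅_

≅-sym : ∀ {F G} → F ≅ G → G ≅ F
≅-sym (equal p q d e) = equal q p e d

≅-c≤ : ∀ {F G} → F ≅ G → c F ≤ c G
≅-c≤ {F} {G} e = pigeonhole ≈c-sym ≈c-trans G (distinct-l e) (⊆cs-fwd e)

≅-c : ∀ {F G} → F ≅ G → c F ≡ c G
≅-c e = ℕₚ.≤-antisym (≅-c≤ e) (≅-c≤ (≅-sym e))

≅-ldeg≤ : ∀ {F G} → F ≅ G → ∀ y → ldeg F y ≤ ldeg G y
≅-ldeg≤ {F} {G} e y = pigeonhole ≈c-sym ≈c-trans (filter (y ∈?_) G)
  (AllPairsₚ.filter⁺ (y ∈?_) (distinct-l e)) (All.tabulate embed)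
  where
  embed : ∀ {D} → D ∈ filter (y ∈?_) F → D ∈c filter (y ∈?_) G
  embed D∈′ with ∈-filter⁻ (y ∈?_) {xs = F} D∈′
  ... | D∈ , y∈ with find (All.lookup (⊆cs-fwd e) D∈)
  ...   | D₁ , D₁∈ , D≈ = lose (∈-filter⁺ (y ∈?_) D₁∈ (proj₁ D≈ y∈)) D≈

≅-ldeg : ∀ {F G} → F ≅ G → ∀ y → ldeg F y ≡ ldeg G y
≅-ldeg e y = ℕₚ.≤-antisym (≅-ldeg≤ e y) (≅-ldeg≤ (≅-sym e) y)

hits-∈c : ∀ {F X Y} → UHIT F → X ∈c F → Y ∈c F → ¬ X ≈c Y → Clash X Y
hits-∈c U X∈ Y∈ X≉Y with find X∈ | find Y∈
... | X₁ , X₁∈ , X≈ | Y₁ , Y₁∈ , Y≈ with hits U X₁∈ Y₁∈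
...   | inj₁ refl = contradiction (≈c-trans X≈ (≈c-sym Y≈)) X≉Y
...   | inj₂ cl   = Clash-resp (proj₂ X≈) (proj₂ Y≈) cl

isClause-∈c : ∀ {F X} → UHIT F → X ∈c F → IsClause X
isClause-∈c U X∈ with find X∈
... | X₁ , X₁∈ , X≈ = IsClause-⊆ (proj₁ X≈) (clauses U X₁∈)

≅-uhit : ∀ {F G} → F ≅ G → UHIT F → UHIT G
≅-uhit {F} {G} e U = uhit (λ D∈ → isClause-∈c U (in-F D∈)) us
  (AllPairs-map-∈ (λ C∈ D∈ → hits-∈c U (in-F C∈) (in-F D∈)) (distinct-r e))
  where
  in-F : ∀ {D} → D ∈ G → D ∈c F
  in-F = All.lookup (⊆cs-bwd e)
  us : ¬ Satisfiable G
  us (T , Tc , meets) = unsat U (T , Tc , All.tabulate meets′)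
    where
    meets′ : ∀ {D} → D ∈ F → Meets T D
    meets′ D∈ with find (All.lookup (⊆cs-fwd e) D∈)
    ... | D₁ , D₁∈ , D≈ with All.lookup meets D₁∈
    ...   | x , x∈T , x∈ = x , x∈T , proj₂ D≈ x∈

minus : Clause → ClauseSet → ClauseSet
minus A = filter (λ D → ¬? (D ≈c? A))

∈-minus⁺ : ∀ {A F D} → D ∈ F → ¬ D ≈c A → D ∈ minus A F
∈-minus⁺ = ∈-filter⁺ _

∈-minus⁻ : ∀ {A F D} → D ∈ minus A F → D ∈ F × ¬ D ≈c A
∈-minus⁻ {A} {F} = ∈-filter⁻ (λ D → ¬? (D ≈c? A)) {xs = F}

∈c-minus : ∀ {A F X} → X ∈c F → ¬ X ≈c A → X ∈c minus A F
∈c-minus {A} X∈ X≉A with find X∈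
... | X₁ , X₁∈ , X≈ = lose (∈-minus⁺ X₁∈ (λ X₁≈A → X≉A (≈c-trans X≈ X₁≈A))) X≈

-- Moves a chosen clause to the head of the list, where sizes and degrees can be read off.
minus-≅ : ∀ {A F} → AllPairs (λ C D → ¬ C ≈c D) F → A ∈c F → F ≅ (A ∷ minus A F)
minus-≅ {A} {F} d A∈ = equal (All.tabulate fwd)
  (A∈ ∷ All.tabulate (λ D∈ → ∈⇒∈c (proj₁ (∈-minus⁻ {A} {F} D∈)))) d
  (All.tabulate (λ D∈ A≈D → proj₂ (∈-minus⁻ {A} {F} D∈) (≈c-sym A≈D)) ∷ AllPairsₚ.filter⁺ _ d)
  where
  fwd : ∀ {D} → D ∈ F → D ∈c (A ∷ minus A F)
  fwd {D} D∈ with D ≈c? A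
  ... | yes D≈A = here D≈A
  ... | no D≉A = there (∈⇒∈c (∈-minus⁺ D∈ D≉A))

≅-trans : ∀ {F G H} → F ≅ G → G ≅ H → F ≅ H
≅-trans {F} {G} {H} e f = equal (⊆cs-trans {F} {G} {H} (⊆cs-fwd e) (⊆cs-fwd f))
  (⊆cs-trans {H} {G} {F} (⊆cs-bwd f) (⊆cs-bwd e)) (distinct-l e) (distinct-r f)
  where
  ⊆cs-trans : ∀ {F G H} → F ⊆cs G → G ⊆cs H → F ⊆cs H
  ⊆cs-trans p q = All.map (λ X∈ → case find X∈ of λ { (Y , Y∈ , X≈) → ∈c-resp (≈c-sym X≈) (All.lookup q Y∈) }) p

≅-cons : ∀ {A F G} → All (λ D → ¬ A ≈c D) F → F ≅ G → (A ∷ F) ≅ (A ∷ G)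
≅-cons {A} {F} {G} A∉F e = equal (here ≈c-refl ∷ All.map there (⊆cs-fwd e)) (here ≈c-refl ∷ All.map there (⊆cs-bwd e))
  (A∉F ∷ distinct-l e) (All.tabulate A∉G ∷ distinct-r e)
  where
  A∉G : ∀ {D} → D ∈ G → ¬ A ≈c D
  A∉G D∈ A≈D with find (All.lookup (⊆cs-bwd e) D∈)
  ... | D₁ , D₁∈ , D≈ = All.lookup A∉F D₁∈ (≈c-trans A≈D D≈)

-- Full subsumption resolution

FsPair : ClauseSet → Set
FsPair F = ∃₂ λ E v → v ∉ E × - v ∉ E × (v ∷ E) ∈c F × (- v ∷ E) ∈c F

-- Both literals have degree one, so `main-⊆-side` applies in both directions and the two clauses
-- agree apart from `v` and `- v`.
1-1-singular⇒fsPair : ∀ {F v} → UHIT F → ldeg F v ≡ 1 → ldeg F (- v) ≡ 1 →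
  ∃ λ E → v ∉ E × - v ∉ E × (v ∷ E) ∈c F × (- v ∷ E) ∈c F
1-1-singular⇒fsPair {F} {v} U dv d-v with ldeg≡1-occurs {F} {v} dv
... | H , H∈ , v∈ with complement-occurs U H∈ v∈
...   | K , K∈ , -v∈ = remove v H ,
        (λ v∈′ → proj₂ (∈-remove⁻ {D = H} v∈′) refl) ,
        (λ -v∈′ → proj₂ (clauses U H∈) v v∈ (remove-⊆ H -v∈′)) ,
        lose H∈ ((λ { (here refl) → v∈ ; (there x∈) → remove-⊆ H x∈ }) , H⊆) ,
        lose K∈ ((λ { (here refl) → -v∈ ; (there x∈) → main-⊆-side U dv H∈ v∈ K∈ -v∈ (remove-⊆ H x∈) (proj₂ (∈-remove⁻ {D = H} x∈)) }) , K⊆)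
  where
  H⊆ : H ⊆ (v ∷ remove v H)
  H⊆ {x} x∈ with x ℤ.≟ v
  ... | yes x≡v = here x≡v
  ... | no x≢v = there (∈-remove⁺ x∈ x≢v)
  K⊆ : K ⊆ (- v ∷ remove v H)
  K⊆ {x} x∈ with x ℤ.≟ - v
  ... | yes x≡-v = here x≡-v
  ... | no x≢-v = there (∈-remove⁺ (main-⊆-side U d-v K∈ -v∈ H∈ (neg∈-neg v∈) x∈ x≢-v)
                          λ { refl → proj₂ (clauses U K∈) v x∈ -v∈ })

-- In a nonsingular clause-set v occurs outside of the pair, so nothing is lost.
fsPair⇒strict : ∀ {F} → UHIT F → NoDegreeOne F → FsPair F → StrictlyFsResolvable F
fsPair⇒strict {F} U nd (E , v , v∉ , -v∉ , A∈ , B∈) =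
  E , v , v≢0 , v∉ , -v∉ , A∈ , B∈ , E∉F , λ w → mk⇔ (to w) (from w)
  where
  v≢0 : v ≢ + 0
  v≢0 = IsClause-≢0 (isClause-∈c U A∈) (here refl)

  A B : Clause
  A = v ∷ E
  B = - v ∷ E

  E∉F : ¬ E ∈c F
  -- In a hitting clause-set `E` would have to clash with its proper superset `A`.
  E∉F E∈ with hits-∈c U E∈ A∈ (λ E≈A → v∉ (proj₂ E≈A (here refl)))
  ... | x , x∈ , here -x≡v = -v∉ (subst (_∈ E) (neg-swap -x≡v) x∈)
  ... | x , x∈ , there -x∈ = proj₂ (isClause-∈c U A∈) x (there x∈) (there -x∈)

  other-v : ∃ λ X → X ∈ F × v ∈ X × ¬ X ≈c A
  other-v with any? (λ X → (v ∈? X) ×-dec ¬? (X ≈c? A)) F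
  ... | yes p = find p
  ... | no none = contradiction deg≡1 (nd v)
    where
    deg≡1 : ldeg F v ≡ 1
    deg≡1 = trans (≅-ldeg (minus-≅ (distinct U) A∈) v) (trans (ldeg-∷-∈ (minus A F) (here refl))
      (cong (suc ∘ length) (Listₚ.filter-none (v ∈?_) {minus A F} (All.tabulate λ D∈ v∈ →
         case ∈-minus⁻ {A} {F} D∈ of λ { (D∈F , D≉A) → none (lose D∈F (v∈ , D≉A)) }))))

  to : ∀ w → w ∈ varList F → ∃ λ X → FsResult F E v X × w ∈ varC X
  to w w∈ with ∈-varList⁻ {F} w∈
  ... | D , x , D∈ , x∈ , refl with ∣ x ∣ ℕ.≟ ∣ v ∣
  ...   | yes eq with other-v
  ...     | X , X∈ , v∈ , X≉A = X , inj₂ (∈⇒∈c X∈ , X≉A , λ X≈B → proj₂ (isClause-∈c U B∈) v (proj₁ X≈B v∈) (here refl)) ,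
            subst (_∈ varC X) (sym eq) (∈-map⁺ ∣_∣ v∈)
  to w w∈ | D , x , D∈ , x∈ , refl | no ≢v with D ≈c? A | D ≈c? B
  ... | no D≉A | no D≉B = D , inj₂ (∈⇒∈c D∈ , D≉A , D≉B) , ∈-map⁺ ∣_∣ x∈
  ... | yes D≈A | _ = E , inj₁ ≈c-refl , ∈-map⁺ ∣_∣ (Any.tail (λ { refl → ≢v refl }) (proj₁ D≈A x∈))
  ... | no _ | yes D≈B = E , inj₁ ≈c-refl , ∈-map⁺ ∣_∣ (Any.tail (λ { refl → ≢v (ℤₚ.∣-i∣≡∣i∣ v) }) (proj₁ D≈B x∈))

  from : ∀ w → (∃ λ X → FsResult F E v X × w ∈ varC X) → w ∈ varList F
  from w (X , r , w∈) with ∈-map⁻ ∣_∣ w∈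
  from w (X , inj₁ X≈E , w∈)      | x , x∈ , refl = ∈c-varList A∈ (there (proj₁ X≈E x∈))
  from w (X , inj₂ (X∈ , _) , w∈) | x , x∈ , refl = ∈c-varList X∈ x∈

fsPair-≅ : ∀ {F E v} → UHIT F → v ∉ E → - v ∉ E → (v ∷ E) ∈c F → (- v ∷ E) ∈c F →
           ∃ λ R → F ≅ ((v ∷ E) ∷ (- v ∷ E) ∷ R)
fsPair-≅ {F} {E} {v} U v∉ -v∉ A∈ B∈ = minus B (minus A F) , ≅-trans (minus-≅ (distinct U) A∈)
  (≅-cons (All.tabulate λ D∈ A≈D → proj₂ (∈-minus⁻ {A} {F} D∈) (≈c-sym A≈D))
          (minus-≅ (AllPairsₚ.filter⁺ _ (distinct U)) (∈c-minus B∈ B≉A)))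
  where
  A B : Clause
  A = v ∷ E
  B = - v ∷ E

  B≉A : ¬ B ≈c A
  B≉A B≈A with proj₁ B≈A (here refl)
  ... | here -v≡v = x≢-x (IsClause-≢0 (isClause-∈c U A∈) (here refl)) (sym -v≡v)
  ... | there -v∈ = -v∉ -v∈

module FsResolution {F : ClauseSet} {E : Clause} {v : Lit} {R : ClauseSet}
  (U : UHIT F) (nd : NoDegreeOne F)
  (v∉ : v ∉ E) (-v∉ : - v ∉ E) (F≅ : F ≅ ((v ∷ E) ∷ (- v ∷ E) ∷ R))
  (strict : ∀ {w} → w ∈ varList F → ∃ λ X → FsResult F E v X × w ∈ varC X) where

  private
    A B : Clause
    A = v ∷ E
    B = - v ∷ E

    in-F : ∀ {X} → X ∈ (A ∷ B ∷ R) → X ∈c F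
    in-F = All.lookup (⊆cs-bwd F≅)

    U₂ : UHIT (A ∷ B ∷ R)
    U₂ = ≅-uhit F≅ U

  resolvent : ClauseSet
  resolvent = E ∷ R

  resolvent-uhit : UHIT resolvent
  resolvent-uhit = uhit cl us hit
    where
    cl : ∀ {D} → D ∈ E ∷ R → IsClause D
    cl (here refl) = IsClause-⊆ there (clauses U₂ (here refl))
    cl (there D∈)  = clauses U₂ (there (there D∈))

    us : ¬ Satisfiable (E ∷ R)
    us (T , Tc , (x , x∈T , x∈E) ∷ meets) =
      unsat U₂ (T , Tc , (x , x∈T , there x∈E) ∷ (x , x∈T , there x∈E) ∷ meets)

    -- `X` cannot clash with `A` in `v` and with `B` in `- v`, as it would contain both literals. So
    -- one of the clashes already uses a literal of `E`.
    E-clash : ∀ {X} → X ∈ R → Clash A X → Clash B X → Clash E X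
    E-clash X∈ (x , there x∈ , -x∈) _ = x , x∈ , -x∈
    E-clash X∈ (_ , here refl , -v∈) (x , there x∈ , -x∈) = x , x∈ , -x∈
    E-clash X∈ (_ , here refl , -v∈) (_ , here refl , v∈) =
      contradiction v∈ (proj₂ (clauses U₂ (there (there X∈))) (- v) -v∈)

    hit : Hitting (E ∷ R)
    hit with hitting U₂
    ... | (_ ∷ A-R) ∷ B-R ∷ R-R =
      All.tabulate (λ X∈ → E-clash X∈ (All.lookup A-R X∈) (All.lookup B-R X∈)) ∷ R-R

  c-resolvent : c F ≡ suc (c resolvent)
  c-resolvent = ≅-c F≅

  n-resolvent : n F ≡ n resolvent
  n-resolvent = ℕₚ.≤-antisym (n-mono {F} {E ∷ R} fwd) (n-mono {E ∷ R} {F} bwd)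
    where
    in-R : ∀ {X} → X ∈c F → ¬ X ≈c A → ¬ X ≈c B → X ∈c R
    in-R X∈ X≉A X≉B with find X∈
    ... | X₁ , X₁∈ , X≈ with All.lookup (⊆cs-fwd F≅) X₁∈
    ...   | here X₁≈A         = contradiction (≈c-trans X≈ X₁≈A) X≉A
    ...   | there (here X₁≈B) = contradiction (≈c-trans X≈ X₁≈B) X≉B
    ...   | there (there X₁∈R) = ∈c-resp (≈c-sym X≈) X₁∈R

    fwd : varList F ⊆ varList (E ∷ R)
    fwd w∈ with strict w∈
    ... | X , r , w∈X with ∈-map⁻ ∣_∣ w∈X
    fwd w∈ | X , inj₁ X≈E , w∈X | x , x∈ , refl = ∈-varList⁺ {E ∷ R} (here refl) (proj₁ X≈E x∈)
    fwd w∈ | X , inj₂ (X∈ , X≉A , X≉B) , w∈X | x , x∈ , refl with find (in-R X∈ X≉A X≉B)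
    ... | X₁ , X₁∈ , X≈ = ∈-varList⁺ {E ∷ R} (there X₁∈) (proj₁ X≈ x∈)

    bwd : varList (E ∷ R) ⊆ varList F
    bwd w∈ with ∈-varList⁻ {E ∷ R} w∈
    ... | D , x , there D∈ , x∈ , refl = ∈c-varList (in-F (there (there D∈))) x∈
    ... | D , x , here refl , x∈ , refl = ∈c-varList (in-F (here refl)) (there x∈)

  private
    ldeg-unchanged : ∀ {y} → y ∉ E → ∣ y ∣ ≢ ∣ v ∣ → ldeg resolvent y ≡ ldeg F y
    ldeg-unchanged {y} y∉ ≢v = begin
      ldeg (E ∷ R) y     ≡⟨ ldeg-∷-∉ R y∉ ⟩
      ldeg R y           ≡⟨ ldeg-∷-∉ R y∉B ⟨
      ldeg (B ∷ R) y     ≡⟨ ldeg-∷-∉ (B ∷ R) y∉A ⟨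
      ldeg (A ∷ B ∷ R) y ≡⟨ ≅-ldeg F≅ y ⟨
      ldeg F y           ∎
      where
      open ≡-Reasoning
      y∉A : y ∉ A
      y∉A (here refl) = ≢v refl
      y∉A (there y∈)  = y∉ y∈
      y∉B : y ∉ B
      y∉B (here refl) = ≢v (ℤₚ.∣-i∣≡∣i∣ v)
      y∉B (there y∈)  = y∉ y∈

    -- Replacing `A` and `B` by `E` affects only the degrees of literals of `E` and of the variable
    -- of `v`. All others are as in `F`, where no degree is one.
    degree-one-cases : ∀ {y} → ldeg resolvent y ≡ 1 → y ∈ E ⊎ ∣ y ∣ ≡ ∣ v ∣
    degree-one-cases {y} dy = cases (y ∈? E) (∣ y ∣ ℕ.≟ ∣ v ∣)
      where
      cases : Dec (y ∈ E) → Dec (∣ y ∣ ≡ ∣ v ∣) → y ∈ E ⊎ ∣ y ∣ ≡ ∣ v ∣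
      cases (yes y∈) _        = inj₁ y∈
      cases (no _)   (yes eq) = inj₂ eq
      cases (no y∉)  (no ≢v)  = contradiction (trans (sym (ldeg-unchanged y∉ ≢v)) dy) (nd y)

  -- At most one literal `x` of `E` has degree one. Its elimination creates no new degree-one
  -- literals, and those left belong to the variable of `v`, which costs at most two more.
  resolvent-reduction : Reduction resolvent 3
  resolvent-reduction with any? (λ x → ldeg resolvent x ℕ.≟ 1) E
  ... | no none = Reduction-weaken (ℕₚ.n≤1+n 2) (reduce-at-variable {resolvent} {∣ v ∣} resolvent-uhit
          λ {y} dy → [ (λ y∈ → contradiction (lose y∈ dy) none) , id ]′ (degree-one-cases {y} dy))
  ... | yes some with find some
  ...   | x , x∈ , dx = Reduction-step El.δ-result El.n-result
          (reduce-at-variable {assign x resolvent} {∣ v ∣} El.result-uhit at-v)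
    where
    module El = Elimination {H = E} resolvent-uhit (here refl) x∈ dx

    ∣-x∣≢∣v∣ : ∣ - x ∣ ≢ ∣ v ∣
    ∣-x∣≢∣v∣ eq with ∣∣-cases {x} {v} (trans (sym (ℤₚ.∣-i∣≡∣i∣ x)) eq)
    ... | inj₁ refl = v∉ x∈
    ... | inj₂ refl = -v∉ x∈

    d-x≢1 : ldeg resolvent (- x) ≢ 1
    -- The literal `- x` is neither in `E` nor on the variable of `v`, so it has the same degree as
    -- in `F`.
    d-x≢1 d-x = nd (- x) (trans (sym (ldeg-unchanged (proj₂ (clauses resolvent-uhit (here refl)) x x∈) ∣-x∣≢∣v∣)) d-x)

    at-v : ∀ {y} → ldeg (assign x resolvent) y ≡ 1 → ∣ y ∣ ≡ ∣ v ∣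
    at-v {y} dy with degree-one-cases {y} (El.no-new-degree-one d-x≢1 dy)
    ... | inj₂ eq = eq
    ... | inj₁ y∈ = contradiction (cong ∣_∣ (main-literal-unique resolvent-uhit (here refl) y∈ x∈
                      (El.no-new-degree-one d-x≢1 dy) dx)) (El.result-degree-one-var dy)

  bound : ∀ {m} → NUpper (δ F ℤ.- + 1) m → n F ≤ m + 3
  bound {m} upper = subst (_≤ m + 3) (sym n-resolvent)
    (Reduction⇒bound resolvent-reduction (subst (λ k → NUpper k m) (sym δ-resolvent) upper))
    where
    δ-resolvent : δ resolvent ≡ δ F ℤ.- + 1
    δ-resolvent = δ-pred {F} {resolvent} c-resolvent n-resolvent

-- Clause-factorisations

IsClause-negate : ∀ {C} → IsClause C → IsClause (map -_ C)
IsClause-negate {C} (nz , nc) = Allₚ.map⁺ (All.map neg-≢0 nz) , consistent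
  where
  consistent : ∀ a → a ∈ map -_ C → - a ∉ map -_ C
  consistent a a∈ -a∈ with ∈-map⁻ -_ a∈ | ∈-map⁻ -_ -a∈
  ... | x , x∈ , refl | y , y∈ , eq = nc x x∈ (subst (_∈ C) (sym (ℤₚ.neg-injective eq)) y∈)

uhit-nonempty : ∀ {F} → UHIT F → ∃ λ D → D ∈ F
uhit-nonempty {[]}    U = contradiction (n<c U) λ ()
uhit-nonempty {D ∷ _} U = D , here refl

-- Used to turn nontriviality of a factorisation into the existence of variables in both factors.
n≡0⇒botSet : ∀ {F} → UHIT F → n F ≡ 0 → IsBotSet F
n≡0⇒botSet {F} U n≡0 = All.tabulate all-empty , nonempty ∷ []
  where
  is-[] : ∀ {D} → D ∈ F → D ≡ []
  is-[] {[]}    D∈ = refl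
  is-[] {_ ∷ _} D∈ = contradiction (subst (0 <_) n≡0 (∈-length (∈-varList⁺ D∈ (here refl)))) λ ()

  all-empty : ∀ {D} → D ∈ F → D ∈c ([] ∷ [])
  all-empty D∈ rewrite is-[] D∈ = here ≈c-refl

  nonempty : [] ∈c F
  nonempty with uhit-nonempty U
  ... | D , D∈ = lose D∈ (subst ([] ≈c_) (sym (is-[] D∈)) ≈c-refl)

nCommon-comm : ∀ F G → nCommon F G ≡ nCommon G F
nCommon-comm F G = ℕₚ.≤-antisym (le F G) (le G F)
  where
  le : ∀ F G → nCommon F G ≤ nCommon G F
  le F G = Unique-⊆-length (AllPairsₚ.filter⁺ _ (varList-unique F))
    λ v∈ → case ∈-filter⁻ (_∈ℕ? varList G) {xs = varList F} v∈ of λ { (v∈F , v∈G) → ∈-filter⁺ (_∈ℕ? varList F) v∈G v∈F }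

n-union : ∀ {F F₀ G} → (∀ {w} → w ∈ varList F → w ∈ varList F₀ ⊎ w ∈ varList G) →
          varList F₀ ⊆ varList F → varList G ⊆ varList F → n F + nCommon F₀ G ≡ n F₀ + n G
n-union {F} {F₀} {G} split F₀⊆ G⊆ = begin
  n F + nCommon F₀ G                     ≡⟨ cong₂ _+_ n≡ (nCommon-comm F₀ G) ⟩
  n F₀ + length new + nCommon G F₀       ≡⟨ ℕₚ.+-assoc (n F₀) _ _ ⟩
  n F₀ + (length new + nCommon G F₀)     ≡⟨ cong (λ k → n F₀ + k) (ℕₚ.+-comm (length new) _) ⟩
  n F₀ + (nCommon G F₀ + length new)     ≡⟨ cong (λ k → n F₀ + k) (length-filter-split (_∈ℕ? varList F₀) (varList G)) ⟨
  n F₀ + n G                             ∎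
  where
  open ≡-Reasoning
  new : List ℕ
  new = filter (¬? ∘ (_∈ℕ? varList F₀)) (varList G)

  ∈-new : ∀ {w} → w ∈ new → w ∈ varList G × w ∉ varList F₀
  ∈-new = ∈-filter⁻ (¬? ∘ (_∈ℕ? varList F₀)) {xs = varList G}

  to : varList F ⊆ varList F₀ ++ new
  to {w} w∈ with w ∈ℕ? varList F₀ | split w∈
  ... | yes p | _ = ∈-++⁺ˡ p
  ... | no ¬p | inj₁ p = contradiction p ¬p
  ... | no ¬p | inj₂ q = ∈-++⁺ʳ (varList F₀) (∈-filter⁺ (¬? ∘ (_∈ℕ? varList F₀)) q ¬p)

  from : varList F₀ ++ new ⊆ varList F
  from w∈ with ∈-++⁻ (varList F₀) w∈
  ... | inj₁ p = F₀⊆ p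
  ... | inj₂ q = G⊆ (proj₁ (∈-new q))

  n≡ : n F ≡ n F₀ + length new
  n≡ = trans (ℕₚ.≤-antisym
    (Unique-⊆-length (varList-unique F) to)
    (Unique-⊆-length (AllPairsₚ.++⁺ (varList-unique F₀) (AllPairsₚ.filter⁺ _ (varList-unique G))
       (All.tabulate λ p → All.tabulate λ { q refl → proj₂ (∈-new q) p })) from))
    (Listₚ.length-++ (varList F₀))

-- `c-F` and `n-F` are subtraction-free: `C` itself disappears from `F₀`, which accounts for the
-- `suc`, and common variables are counted in both factors.
record Factors (F F₀ G : ClauseSet) (C : Clause) : Set where
  field
    F₀-uhit  : UHIT F₀
    G-uhit   : UHIT G
    C∈F₀     : C ∈ F₀
    disjoint : ∀ {x} → x ∈ C → ∣ x ∣ ∉ varList G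
    left     : ∀ {X} → X ∈c F₀ → ¬ X ≈c C → X ∈c F
    right    : ∀ {D} → D ∈ G → (C ++ D) ∈c F
    ldeg-F   : ∀ {y} → y ∉ C → ldeg F y ≡ ldeg F₀ y + ldeg G y
    c-F      : suc (c F) ≡ c F₀ + c G
    n-F      : n F + nCommon F₀ G ≡ n F₀ + n G

-- The factors inherit hitting from `F`. Two clauses `C ++ D` and `C ++ D′` can only clash between
-- `D` and `D′`, by disjointness of variables. Clauses of `F₀` other than `C` are clauses of `F`. An
-- assignment satisfying `F₀` satisfies `C`, hence every `C ++ D`, and so all of `F`.
factors : ∀ {F F₀ G C} → UHIT F → ClauseFactorisation F F₀ C G → Factors F F₀ G C
factors {F} {F₀} {G} {C} U ((F₀-cl , F₀-distinct) , (G-cl , G-distinct) , C∈ , disj , sep , G-unsat , iff) = record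
  { F₀-uhit = F₀-U ; G-uhit = G-U ; C∈F₀ = C∈ ; disjoint = disjoint ; left = left ; right = right
  ; ldeg-F = ldeg-F ; c-F = c-F ; n-F = n-union {F} {F₀} {G} n-split F₀⊆F G⊆F }
  where
  disjoint : ∀ {x} → x ∈ C → ∣ x ∣ ∉ varList G
  disjoint x∈ = disj _ (∈-map⁺ ∣_∣ x∈)

  left : ∀ {X} → X ∈c F₀ → ¬ X ≈c C → X ∈c F
  left {X} X∈ X≉C = Equivalence.from (iff X) (inj₁ (X∈ , X≉C))

  no-clash : ∀ {D} → D ∈ G → NoClash C D
  no-clash D∈ x x∈C -x∈D = disjoint x∈C (subst (_∈ varList G) (ℤₚ.∣-i∣≡∣i∣ x) (∈-varList⁺ D∈ -x∈D))

  right : ∀ {D} → D ∈ G → (C ++ D) ∈c F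
  right {D} D∈ = Equivalence.from (iff (C ++ D)) (inj₂ (D , D∈ , no-clash D∈ , ≈c-refl))

  C-cl : IsClause C
  C-cl = All.lookup F₀-cl C∈

  cancel-C : ∀ {D D′} → D ∈ G → (C ++ D) ⊆ (C ++ D′) → D ⊆ D′
  cancel-C D∈ s x∈ with ∈-++⁻ C (s (∈-++⁺ʳ C x∈))
  ... | inj₁ x∈C = contradiction (∈-varList⁺ D∈ x∈) (disjoint x∈C)
  ... | inj₂ x∈D′ = x∈D′

  C++-distinct : AllPairs (λ D D′ → ¬ (C ++ D) ≈c (C ++ D′)) G
  C++-distinct = AllPairs-map-∈ (λ D∈ D′∈ D≉ (s , t) → D≉ (cancel-C D∈ s , cancel-C D′∈ t)) G-distinct

  G-clash : ∀ {D D′} → D ∈ G → D′ ∈ G → ¬ (C ++ D) ≈c (C ++ D′) → Clash D D′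
  G-clash {D} {D′} D∈ D′∈ ≉ with hits-∈c U (right D∈) (right D′∈) ≉
  ... | x , x∈ , -x∈ with ∈-++⁻ C x∈ | ∈-++⁻ C -x∈
  ...   | inj₁ p | inj₁ q = contradiction q (proj₂ C-cl x p)
  ...   | inj₁ p | inj₂ q = contradiction q (no-clash D′∈ x p)
  ...   | inj₂ p | inj₁ q = contradiction (neg∈-neg p) (no-clash D∈ (- x) q)
  ...   | inj₂ p | inj₂ q = x , p , q

  G-U : UHIT G
  G-U = uhit (All.lookup G-cl) G-unsat (AllPairs-map-∈ G-clash C++-distinct)

  -- Otherwise the assignment falsifying X would satisfy G.
  clash-C : ∀ {X} → X ∈ F₀ → ¬ X ≈c C → Clash X C
  clash-C {X} X∈ X≉C with any? (λ x → - x ∈? C) X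
  ... | yes p = find p
  ... | no ¬p = contradiction (map -_ X , IsClause-negate (All.lookup F₀-cl X∈) , All.tabulate meets) G-unsat
    where
    meets : ∀ {D} → D ∈ G → Meets (map -_ X) D
    meets {D} D∈ with hits-∈c U (left (∈⇒∈c X∈) X≉C) (right D∈)
                        (λ X≈ → sep X (∈⇒∈c X∈ , X≉C) (D , D∈ , no-clash D∈ , X≈))
    ... | x , x∈ , -x∈ with ∈-++⁻ C -x∈
    ...   | inj₁ -x∈C = contradiction (lose x∈ -x∈C) ¬p
    ...   | inj₂ -x∈D = - x , ∈-map⁺ -_ x∈ , -x∈D

  F₀-clash : ∀ {X Y} → X ∈ F₀ → Y ∈ F₀ → ¬ X ≈c Y → Clash X Y
  F₀-clash {X} {Y} X∈ Y∈ X≉Y with X ≈c? C | Y ≈c? C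
  ... | yes X≈C | yes Y≈C = contradiction (≈c-trans X≈C (≈c-sym Y≈C)) X≉Y
  ... | yes X≈C | no Y≉C  = Clash-resp (proj₂ X≈C) id (Clash-sym (clash-C Y∈ Y≉C))
  ... | no X≉C  | yes Y≈C = Clash-resp id (proj₂ Y≈C) (clash-C X∈ X≉C)
  ... | no X≉C  | no Y≉C  = hits-∈c U (left (∈⇒∈c X∈) X≉C) (left (∈⇒∈c Y∈) Y≉C) X≉Y

  F₀-unsat : ¬ Satisfiable F₀
  F₀-unsat (T , Tc , meets) = unsat U (T , Tc , All.tabulate meets′)
    where
    meets′ : ∀ {X} → X ∈ F → Meets T X
    meets′ {X} X∈ with Equivalence.to (iff X) (∈⇒∈c X∈)
    ... | inj₁ (X∈F₀ , _) with find X∈F₀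
    ...   | X₁ , X₁∈ , X≈ with All.lookup meets X₁∈
    ...     | x , x∈T , x∈ = x , x∈T , proj₂ X≈ x∈
    meets′ {X} X∈ | inj₂ (D , D∈ , _ , X≈) with All.lookup meets C∈
    ...     | x , x∈T , x∈ = x , x∈T , proj₂ X≈ (∈-++⁺ˡ x∈)

  F₀-U : UHIT F₀
  F₀-U = uhit (All.lookup F₀-cl) F₀-unsat (AllPairs-map-∈ F₀-clash F₀-distinct)

  R : ClauseSet
  R = minus C F₀

  F₀≅ : F₀ ≅ (C ∷ R)
  F₀≅ = minus-≅ F₀-distinct (∈⇒∈c C∈)

  F≅ : F ≅ (R ++ map (C ++_) G)
  -- Adding `C` is injective on `G`, and `sep` keeps the two parts apart, so the concatenation has
  -- no repetitions.
  F≅ = equal (All.tabulate fwd) (Allₚ.++⁺ (All.tabulate R⊆F) (Allₚ.map⁺ (All.tabulate right))) (distinct U)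
    (AllPairsₚ.++⁺ (AllPairsₚ.filter⁺ _ F₀-distinct) (AllPairsₚ.map⁺ C++-distinct)
      (All.tabulate λ X∈ → Allₚ.map⁺ (All.tabulate λ {D} D∈ X≈ →
        case ∈-minus⁻ {C} {F₀} X∈ of λ { (X∈F₀ , X≉C) → sep _ (∈⇒∈c X∈F₀ , X≉C) (D , D∈ , no-clash D∈ , X≈) })))
    where
    R⊆F : ∀ {X} → X ∈ R → X ∈c F
    R⊆F X∈ with ∈-minus⁻ {C} {F₀} X∈
    ... | X∈F₀ , X≉C = left (∈⇒∈c X∈F₀) X≉C
    fwd : ∀ {X} → X ∈ F → X ∈c (R ++ map (C ++_) G)
    fwd {X} X∈ with Equivalence.to (iff X) (∈⇒∈c X∈)
    ... | inj₁ (X∈F₀ , X≉C) = Anyₚ.++⁺ˡ (∈c-minus X∈F₀ X≉C)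
    ... | inj₂ (D , D∈ , _ , X≈) = Anyₚ.++⁺ʳ R (Anyₚ.map⁺ (lose D∈ X≈))

  c-F : suc (c F) ≡ c F₀ + c G
  c-F = begin
    suc (c F)                             ≡⟨ cong suc (≅-c F≅) ⟩
    suc (length (R ++ map (C ++_) G))     ≡⟨ cong suc (Listₚ.length-++ R) ⟩
    suc (length R + length (map (C ++_) G)) ≡⟨ cong (λ k → suc (length R + k)) (Listₚ.length-map (C ++_) G) ⟩
    suc (length R) + c G                  ≡⟨ cong (_+ c G) (≅-c F₀≅) ⟨
    c F₀ + c G                            ∎
    where open ≡-Reasoning

  ldeg-F : ∀ {y} → y ∉ C → ldeg F y ≡ ldeg F₀ y + ldeg G y
  ldeg-F {y} y∉ = begin
    ldeg F y                              ≡⟨ ≅-ldeg F≅ y ⟩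
    ldeg (R ++ map (C ++_) G) y           ≡⟨ ldeg-++ R (map (C ++_) G) y ⟩
    ldeg R y + ldeg (map (C ++_) G) y     ≡⟨ cong₂ _+_ ldeg-R (ldeg-map (C ++_) G λ {D} →
                                               ∈-++⁺ʳ C , λ y∈ → [ (λ y∈C → contradiction y∈C y∉) , id ]′ (∈-++⁻ C y∈)) ⟩
    ldeg F₀ y + ldeg G y                  ∎
    where
    open ≡-Reasoning
    ldeg-R : ldeg R y ≡ ldeg F₀ y
    ldeg-R = trans (sym (ldeg-∷-∉ R y∉)) (sym (≅-ldeg F₀≅ y))

  some-D : ∃ λ D → D ∈ G
  some-D = uhit-nonempty G-U

  F₀⊆F : varList F₀ ⊆ varList F
  F₀⊆F w∈ with ∈-varList⁻ {F₀} w∈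
  ... | X , x , X∈ , x∈ , refl with X ≈c? C
  ...   | no X≉C = ∈c-varList (left (∈⇒∈c X∈) X≉C) x∈
  ...   | yes X≈C = ∈c-varList (right (proj₂ some-D)) (∈-++⁺ˡ (proj₁ X≈C x∈))

  G⊆F : varList G ⊆ varList F
  G⊆F w∈ with ∈-varList⁻ {G} w∈
  ... | D , x , D∈ , x∈ , refl = ∈c-varList (right D∈) (∈-++⁺ʳ C x∈)

  n-split : ∀ {w} → w ∈ varList F → w ∈ varList F₀ ⊎ w ∈ varList G
  n-split w∈ with ∈-varList⁻ {F} w∈
  ... | X , x , X∈ , x∈ , refl with Equivalence.to (iff X) (∈⇒∈c X∈)
  ...   | inj₁ (X∈F₀ , _) = inj₁ (∈c-varList X∈F₀ x∈)
  ...   | inj₂ (D , D∈ , _ , X≈) with ∈-++⁻ C (proj₁ X≈ x∈)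
  ...     | inj₁ x∈C = inj₁ (∈-varList⁺ C∈ x∈C)
  ...     | inj₂ x∈D = inj₂ (∈-varList⁺ D∈ x∈D)

-- By `n<c` the deficiency is positive; writing it as `suc a` keeps the counting in the natural
-- numbers.
deficiency : ∀ {F} → UHIT F → ∃ λ a → c F ≡ suc (n F + a)
deficiency {F} U with ℕₚ.m≤n⇒∃[o]m+o≡n (n<c U)
... | a , eq = a , sym eq

δ-value : ∀ {F a} → c F ≡ suc (n F + a) → δ F ≡ + suc a
δ-value {F} {a} eq = trans (cong (λ k → + k ℤ.- + n F) eq) (cancel (+ n F) (+ a))
  where
  cancel : ∀ i j → + 1 ℤ.+ (i ℤ.+ j) ℤ.- i ≡ + 1 ℤ.+ j
  cancel = solve-∀

-- Degree-one literals of the two factors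

module _ {F F₀ G : ClauseSet} {C : Clause} (U : UHIT F) (nd : NoDegreeOne F)
         (Fac : Factors F F₀ G C) (n₀≢0 : n F₀ ≢ 0) (n₁≢0 : n G ≢ 0) where

  open Factors Fac

  common : List ℕ
  common = filter (_∈ℕ? varList G) (varList F₀)

  ∈-common : ∀ {w} → w ∈ varList F₀ → w ∈ varList G → w ∈ common
  ∈-common = ∈-filter⁺ (_∈ℕ? varList G)

  -- A literal outside `C` whose variable is not in `G` has the same degree in `F` as in `F₀`, and
  -- no degree in `F` is one.
  degree-one-F₀ : ∀ {y} → ldeg F₀ y ≡ 1 → y ∈ C ⊎ ∣ y ∣ ∈ varList G
  degree-one-F₀ {y} dy = cases (y ∈? C) (∣ y ∣ ∈ℕ? varList G)
    where
    cases : Dec (y ∈ C) → Dec (∣ y ∣ ∈ varList G) → y ∈ C ⊎ ∣ y ∣ ∈ varList G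
    cases (yes p) _       = inj₁ p
    cases (no _)  (yes q) = inj₂ q
    cases (no y∉) (no ¬q) = contradiction (trans (ldeg-F y∉) (cong₂ _+_ dy (ldeg≡0 {G} {y} ¬q))) (nd y)

  degree-one-G : ∀ {y} → ldeg G y ≡ 1 → ∣ y ∣ ∈ varList F₀
  degree-one-G {y} dy = cases (∣ y ∣ ∈ℕ? varList F₀)
    where
    cases : Dec (∣ y ∣ ∈ varList F₀) → ∣ y ∣ ∈ varList F₀
    cases (yes p) = p
    cases (no ¬p) = contradiction (trans (ldeg-F λ y∈C → disjoint y∈C (ldeg≡1-∈var {G} dy))
                                         (cong₂ _+_ (ldeg≡0 {F₀} {y} ¬p) dy)) (nd y)

  -- `C` does not contain both `y` and `- y`, so one of them falls under the second case of
  -- `degree-one-F₀`.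
  1-1-singular-F₀ : ∀ {y} → ldeg F₀ y ≡ 1 → ldeg F₀ (- y) ≡ 1 → ∣ y ∣ ∈ varList G
  1-1-singular-F₀ {y} dy d-y with degree-one-F₀ {y} dy | degree-one-F₀ { - y} d-y
  ... | inj₂ p | _ = p
  ... | inj₁ _ | inj₂ q = subst (_∈ varList G) (ℤₚ.∣-i∣≡∣i∣ y) q
  ... | inj₁ p | inj₁ q = contradiction q (proj₂ (clauses F₀-uhit C∈F₀) y p)

  ∣-y∣∈ : ∀ {y} → ∣ y ∣ ∈ varList G → ∣ - y ∣ ∈ varList G
  ∣-y∣∈ {y} = subst (_∈ varList G) (sym (ℤₚ.∣-i∣≡∣i∣ y))

  -- The variable of the pair is common to both factors and hence not in `C`. So neither clause of
  -- the pair is `C`, and both survive in `F`.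
  fsPair-from-F₀ : ∀ {y} → ldeg F₀ y ≡ 1 → ldeg F₀ (- y) ≡ 1 → FsPair F
  fsPair-from-F₀ {y} dy d-y with 1-1-singular⇒fsPair F₀-uhit dy d-y
  ... | E , y∉ , -y∉ , A∈ , B∈ = E , y , y∉ , -y∉ ,
        left A∈ (λ A≈C → disjoint (proj₁ A≈C (here refl)) y∈G) ,
        left B∈ (λ B≈C → disjoint (proj₁ B≈C (here refl)) (∣-y∣∈ {y} y∈G))
    where
    y∈G : ∣ y ∣ ∈ varList G
    y∈G = 1-1-singular-F₀ dy d-y

  -- Adding `C`, which does not contain the variable of the pair, to both clauses gives a pair in
  -- `F`.
  fsPair-from-G : ∀ {y} → ldeg G y ≡ 1 → ldeg G (- y) ≡ 1 → FsPair F
  fsPair-from-G {y} dy d-y with 1-1-singular⇒fsPair G-uhit dy d-y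
  ... | E , y∉ , -y∉ , A∈ , B∈ = C ++ E , y ,
        (λ y∈ → [ (λ y∈C → disjoint y∈C y∈G) , y∉ ]′ (∈-++⁻ C y∈)) ,
        (λ -y∈ → [ (λ -y∈C → disjoint -y∈C (∣-y∣∈ {y} y∈G)) , -y∉ ]′ (∈-++⁻ C -y∈)) ,
        lift A∈ , lift B∈
    where
    y∈G : ∣ y ∣ ∈ varList G
    y∈G = ldeg≡1-∈var {G} dy
    lift : ∀ {z E} → (z ∷ E) ∈c G → (z ∷ C ++ E) ∈c F
    lift {z} {E} A∈ with find A∈
    ... | D , D∈ , A≈D = ∈c-resp ((λ x∈ → [ there ∘ ∈-++⁺ˡ , from-D ∘ proj₂ A≈D ]′ (∈-++⁻ C x∈)) , into) (right D∈)
      where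
      from-D : (z ∷ E) ⊆ (z ∷ C ++ E)
      from-D (here eq)  = here eq
      from-D (there x∈) = there (∈-++⁺ʳ C x∈)
      into : (z ∷ C ++ E) ⊆ (C ++ D)
      into (here refl) = ∈-++⁺ʳ C (proj₁ A≈D (here refl))
      into (there x∈)  = [ ∈-++⁺ˡ , (λ x∈E → ∈-++⁺ʳ C (proj₁ A≈D (there x∈E))) ]′ (∈-++⁻ C x∈)

  module _ (¬strict : ¬ StrictlyFsResolvable F) where

    no-1-1-F₀ : No-1-1-singular F₀
    no-1-1-F₀ y dy d-y = ¬strict (fsPair⇒strict U nd (fsPair-from-F₀ {y} dy d-y))

    no-1-1-G : No-1-1-singular G
    no-1-1-G y dy d-y = ¬strict (fsPair⇒strict U nd (fsPair-from-G {y} dy d-y))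

    G-reduction : Reduction G (length common)
    G-reduction = reduce common G-uhit no-1-1-G λ {y} dy → ∈-common (degree-one-G {y} dy) (ldeg≡1-∈var {G} {y} dy)

    -- Besides the common variables only one elimination can be necessary, since at most one literal
    -- of `C` has degree one.
    F₀-reduction : Reduction F₀ (suc (length common))
    F₀-reduction with any? (λ x → ldeg F₀ x ℕ.≟ 1) C
    ... | no none = Reduction-weaken (ℕₚ.n≤1+n _) (reduce common F₀-uhit no-1-1-F₀ λ {y} dy →
            [ (λ y∈C → contradiction (lose y∈C dy) none) , ∈-common (ldeg≡1-∈var {F₀} {y} dy) ]′ (degree-one-F₀ {y} dy))
    ... | yes some with find some
    ...   | x , x∈ , dx = reduce (∣ x ∣ ∷ common) F₀-uhit no-1-1-F₀ λ {y} dy →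
            [ (λ y∈C → here (cong ∣_∣ (main-literal-unique F₀-uhit C∈F₀ y∈C x∈ dy dx)))
            , there ∘ ∈-common (ldeg≡1-∈var {F₀} {y} dy) ]′ (degree-one-F₀ {y} dy)

    -- With `q` common variables, the two reductions cost `2q + 1` variables together; `q` of these
    -- are saved because `F` counts common variables only once.
    nonresolvable-bound : ∀ {m₁ m₂} → NUpper (δ F₀) m₁ → NUpper (δ G) m₂ →
                          n F ≤ m₁ + m₂ + nCommon F₀ G + 1
    nonresolvable-bound {m₁} {m₂} b₁ b₂ = ℕₚ.+-cancelʳ-≤ q _ _ (begin
      n F + q                         ≡⟨ n-F ⟩
      n F₀ + n G                      ≤⟨ ℕₚ.+-mono-≤ (Reduction⇒bound F₀-reduction b₁) (Reduction⇒bound G-reduction b₂) ⟩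
      (m₁ + suc q) + (m₂ + q)         ≡⟨ rearrange m₁ m₂ q ⟩
      m₁ + m₂ + q + 1 + q             ∎)
      where
      open ℕₚ.≤-Reasoning
      q : ℕ
      q = nCommon F₀ G
      rearrange : ∀ a b q → (a + (1 + q)) + (b + q) ≡ a + b + q + 1 + q
      rearrange = ℕ-solve-∀

  -- Deficiency one forces a variable occurring once in each sign, and such a variable must be
  -- common.
  δ₀≡1⇒common : c F₀ ≡ suc (n F₀) → 0 < nCommon F₀ G
  δ₀≡1⇒common c≡ with ∃-1-1-singular F₀-uhit n₀≢0 c≡
  ... | y , dy , d-y = ∈-length (∈-common (ldeg≡1-∈var {F₀} {y} dy) (1-1-singular-F₀ {y} dy d-y))

  δ₁≡1⇒common : c G ≡ suc (n G) → 0 < nCommon F₀ G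
  δ₁≡1⇒common c≡ with ∃-1-1-singular G-uhit n₁≢0 c≡
  ... | y , dy , d-y = ∈-length (∈-common (degree-one-G {y} dy) (ldeg≡1-∈var {G} {y} dy))

  -- One common variable and both factors of deficiency one

  module _ (q≡1 : nCommon F₀ G ≡ 1) (c₀≡ : c F₀ ≡ suc (n F₀)) (c₁≡ : c G ≡ suc (n G)) where

    common-unique : ∀ {u w} → u ∈ varList F₀ → u ∈ varList G → w ∈ varList F₀ → w ∈ varList G → u ≡ w
    common-unique u∈ u∈′ w∈ w∈′ = singleton common q≡1 (∈-common u∈ u∈′) (∈-common w∈ w∈′)
      where
      singleton : ∀ {u w : ℕ} xs → length xs ≡ 1 → u ∈ xs → w ∈ xs → u ≡ w
      singleton (_ ∷ []) _ (here refl) (here refl) = refl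

    -- Eliminate the common variable, the only one in `G` with degree-one literals. If variables
    -- remained, some `z` would occur once in each sign. Both degrees would be new, placing `z` and
    -- `- z` in the main clause `H`.
    n-G≡1 : n G ≡ 1
    n-G≡1 with ∃-1-1-singular G-uhit n₁≢0 c₁≡
    ... | y , dy , _ with ldeg≡1-occurs {G} {y} dy
    ...   | H , H∈ , y∈ with n (assign y G) ℕ.≟ 0
    ...     | yes n≡0 = trans (Elimination.n-result G-uhit H∈ y∈ dy) (cong suc n≡0)
    ...     | no n≢0 with ∃-1-1-singular (Elimination.result-uhit G-uhit H∈ y∈ dy) n≢0
                            (ℕₚ.suc-injective (trans (sym (Elimination.c-result G-uhit H∈ y∈ dy))
                               (trans c₁≡ (cong suc (Elimination.n-result G-uhit H∈ y∈ dy)))))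
    ...       | z , dz , d-z = contradiction (in-H (- z) d-z) (proj₂ (clauses G-uhit H∈) z (in-H z dz))
      where
      module El = Elimination G-uhit H∈ y∈ dy
      in-H : ∀ w → ldeg (assign y G) w ≡ 1 → w ∈ H
      in-H w dw = El.changed-∈main dw λ dw′ → El.result-degree-one-var dw
        (common-unique (degree-one-G {w} dw′) (ldeg≡1-∈var {G} {w} dw′) (degree-one-G {y} dy) (ldeg≡1-∈var {G} {y} dy))

    -- Eliminate the common variable and let `u` occur once in each sign afterwards. As `u` and
    -- `- u` are not both in `H`, one of them had degree one before and so lies in `C`. Eliminating
    -- its variable leaves none.
    n-F₀≤2 : n F₀ ≤ 2
    n-F₀≤2 with ∃-1-1-singular F₀-uhit n₀≢0 c₀≡
    ... | y , dy , d-y with ldeg≡1-occurs {F₀} {y} dy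
    ...   | H , H∈ , y∈ = subst (_≤ 2) (sym El.n-result) (s≤s n₁≤1)
      where
      module El = Elimination F₀-uhit H∈ y∈ dy
      F₁ : ClauseSet
      F₁ = assign y F₀

      y∈G : ∣ y ∣ ∈ varList G
      y∈G = 1-1-singular-F₀ {y} dy d-y

      y∉C : y ∉ C
      y∉C y∈C = disjoint y∈C y∈G

      private-var : ∀ {w} → ∣ w ∣ ∈ varList F₁ → ∣ w ∣ ∉ varList G
      private-var w∈₁ w∈G with varList-assign {y} {F₀} w∈₁
      ... | w∈₀ , w≢ = w≢ (common-unique w∈₀ w∈G (∈-varList⁺ H∈ y∈) y∈G)

      degree-one-∈C : ∀ {w} → ∣ w ∣ ∈ varList F₁ → ldeg F₀ w ≡ 1 → w ∈ C
      degree-one-∈C {w} w∈₁ dw = [ id , (λ w∈G → contradiction w∈G (private-var {w} w∈₁)) ]′ (degree-one-F₀ {w} dw)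

      c₁≡′ : c F₁ ≡ suc (n F₁)
      c₁≡′ = ℕₚ.suc-injective (trans (sym El.c-result) (trans c₀≡ (cong suc El.n-result)))

      -- C and the side clause of y form the pair of u in F₁, so a further
      -- (1,1)-singular variable would have a literal outside of C.
      at-most-one : ∀ u → ldeg F₁ u ≡ 1 → ldeg F₁ (- u) ≡ 1 → ldeg F₀ u ≡ 1 → n F₁ ≤ 1
      at-most-one u du d-u du₀ with El.side-clause
      ... | K , K∈ , -y∈ , y∉K = subst (_≤ 1) (sym El₁.n-result) (s≤s n₂≤0)
        where
        u∈C : u ∈ C
        u∈C = degree-one-∈C (ldeg≡1-∈var {F₁} {u} du) du₀

        main side : Clause
        main = remove (- y) C
        side = remove (- y) K

        in-side : ∀ {w} → ldeg F₁ w ≡ 1 → w ∈ H → w ∈ side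
        in-side {w} dw w∈H = ∈-remove⁺ (main-⊆-side F₀-uhit dy H∈ y∈ K∈ -y∈ w∈H
          (λ { refl → El.result-degree-one-var {w} dw refl })) (El.result-degree-one-≢- dw)

        -u∈side : - u ∈ side
        -- In `F₀` the literal `- u` did not have degree one, since it would then lie in `C` beside
        -- `u`. Its degree has changed, so it comes from `H`.
        -u∈side = in-side d-u (El.changed-∈main d-u λ d-u₀ →
          proj₂ (clauses F₀-uhit C∈F₀) u u∈C (degree-one-∈C (ldeg≡1-∈var {F₁} { - u} d-u) d-u₀))

        main∈ : main ∈ F₁
        main∈ = ∈-assign⁺ C∈F₀ y∉C

        u∈main : u ∈ main
        u∈main = ∈-remove⁺ u∈C (El.result-degree-one-≢- du)

        module El₁ = Elimination El.result-uhit main∈ u∈main du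

        in-C : ∀ w → ldeg (assign u F₁) w ≡ 1 → w ∈ C
        in-C w dw = cases (w ∈? C) (w ∈? H)
          where
          cases : Dec (w ∈ C) → Dec (w ∈ H) → w ∈ C
          cases (yes w∈) _ = w∈
          cases (no w∉) w∈H? = by-H w∈H?
            where
            dw₁ : ldeg F₁ w ≡ 1
            dw₁ = trans (El₁.ldeg-∉main (λ w∈ → w∉ (remove-⊆ C w∈)) (El₁.result-degree-one-≢- dw)) dw
            by-H : Dec (w ∈ H) → w ∈ C
            by-H (no w∉H)  = degree-one-∈C (ldeg≡1-∈var {F₁} {w} dw₁)
              (trans (El.ldeg-∉main w∉H (El.result-degree-one-≢- dw₁)) dw₁)
            -- For `- u` the roles are exchanged: `side` is its main clause and `main` its side
            -- clause, so `w` passes from `side` to `main`.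
            by-H (yes w∈H) = remove-⊆ C (main-⊆-side El.result-uhit d-u (∈-assign⁺ K∈ y∉K) -u∈side main∈
              (neg∈-neg u∈main) (in-side dw₁ w∈H) (El₁.result-degree-one-≢- dw))

        n₂≤0 : n (assign u F₁) ≤ 0
        n₂≤0 with n (assign u F₁) ℕ.≟ 0
        ... | yes n≡0 = ℕₚ.≤-reflexive n≡0
        ... | no n≢0 with ∃-1-1-singular El₁.result-uhit n≢0
                            (ℕₚ.suc-injective (trans (sym El₁.c-result) (trans c₁≡′ (cong suc El₁.n-result))))
        ...   | z , dz , d-z = contradiction (in-C (- z) d-z) (proj₂ (clauses F₀-uhit C∈F₀) z (in-C z dz))

      n₁≤1 : n F₁ ≤ 1
      n₁≤1 with n F₁ ℕ.≟ 0
      ... | yes n≡0 = subst (_≤ 1) (sym n≡0) z≤n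
      ... | no n≢0 with ∃-1-1-singular El.result-uhit n≢0 c₁≡′
      ...   | u , du , d-u = cases (ldeg F₀ u ℕ.≟ 1) (ldeg F₀ (- u) ℕ.≟ 1)
        where
        cases : Dec (ldeg F₀ u ≡ 1) → Dec (ldeg F₀ (- u) ≡ 1) → n F₁ ≤ 1
        cases (yes du₀) _ = at-most-one u du d-u du₀
        cases (no _) (yes d-u₀) = at-most-one (- u) d-u (trans (cong (ldeg F₁) (ℤₚ.neg-involutive u)) du) d-u₀
        cases (no ¬du₀) (no ¬d-u₀) =
          contradiction (El.changed-∈main d-u ¬d-u₀) (proj₂ (clauses F₀-uhit H∈) u (El.changed-∈main du ¬du₀))

    n-F≤2 : n F ≤ 2
    n-F≤2 = ℕₚ.+-cancelʳ-≤ 1 _ _ (begin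
      n F + 1                ≡⟨ cong (λ k → n F + k) q≡1 ⟨
      n F + nCommon F₀ G     ≡⟨ n-F ⟩
      n F₀ + n G             ≤⟨ ℕₚ.+-mono-≤ n-F₀≤2 (ℕₚ.≤-reflexive n-G≡1) ⟩
      3                      ∎)
      where open ℕₚ.≤-Reasoning

  -- The deficiency of the product

  module _ {a b : ℕ} (c₀≡ : c F₀ ≡ suc (n F₀ + a)) (c₁≡ : c G ≡ suc (n G + b)) where

    private
      q e : ℕ
      q = nCommon F₀ G
      e = q + a + b

    -- The deficiencies of `F`, `F₀`, `G` being `suc e`, `suc a`, `suc b`, this says that the first
    -- is the sum of the other two plus the number of common variables minus one.
    c-F≡ : c F ≡ suc (n F + e)
    c-F≡ = ℕₚ.suc-injective (begin
      suc (c F)                           ≡⟨ c-F ⟩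
      c F₀ + c G                          ≡⟨ cong₂ _+_ c₀≡ c₁≡ ⟩
      suc (n F₀ + a) + suc (n G + b)      ≡⟨ gather (n F₀) (n G) a b ⟩
      2 + (n F₀ + n G + (a + b))          ≡⟨ cong (λ k → 2 + (k + (a + b))) n-F ⟨
      2 + (n F + q + (a + b))             ≡⟨ regroup (n F) q a b ⟩
      2 + (n F + e)                       ∎)
      where
      open ≡-Reasoning
      gather : ∀ x y a b → (1 + (x + a)) + (1 + (y + b)) ≡ 2 + (x + y + (a + b))
      gather = ℕ-solve-∀
      regroup : ∀ x q a b → 2 + (x + q + (a + b)) ≡ 2 + (x + (q + a + b))
      regroup = ℕ-solve-∀

    a≡0⇒c₀ : a ≡ 0 → c F₀ ≡ suc (n F₀)
    a≡0⇒c₀ refl = trans c₀≡ (cong suc (ℕₚ.+-identityʳ (n F₀)))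

    b≡0⇒c₁ : b ≡ 0 → c G ≡ suc (n G)
    b≡0⇒c₁ refl = trans c₁≡ (cong suc (ℕₚ.+-identityʳ (n G)))

    e≥1 : 1 ≤ e
    e≥1 with a ℕ.≟ 0
    ... | yes a≡0 = ℕₚ.≤-trans (δ₀≡1⇒common (a≡0⇒c₀ a≡0)) (ℕₚ.≤-trans (ℕₚ.m≤m+n q a) (ℕₚ.m≤m+n (q + a) b))
    ... | no a≢0  = ℕₚ.≤-trans (ℕₚ.n≢0⇒n>0 a≢0) (ℕₚ.≤-trans (ℕₚ.m≤n+m a q) (ℕₚ.m≤m+n (q + a) b))

    -- Without common variables both `a` and `b` would be positive and `e` at least two. Hence there
    -- is one common variable and both factors have deficiency one.
    e≡1⇒n≤2 : e ≡ 1 → n F ≤ 2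
    e≡1⇒n≤2 e≡1 with split q a b e≡1 (δ₀≡1⇒common ∘ a≡0⇒c₀) (δ₁≡1⇒common ∘ b≡0⇒c₁)
      where
      split : ∀ q a b → q + a + b ≡ 1 → (a ≡ 0 → 0 < q) → (b ≡ 0 → 0 < q) → q ≡ 1 × a ≡ 0 × b ≡ 0
      split 1 0 0 _  _  _ = refl , refl , refl
      split 0 0 _ _  f _ = contradiction (f refl) λ ()
      split 0 1 0 _  _ g = contradiction (g refl) λ ()
    ... | q≡1 , a≡0 , b≡0 = n-F≤2 q≡1 (a≡0⇒c₀ a≡0) (b≡0⇒c₁ b≡0)

    -- For `a ≡ 0` a variable occurs once in each sign in `F₀`, and its pair would make `F` strictly
    -- fs-resolvable.
    ¬strict⇒a≢0 : ¬ StrictlyFsResolvable F → a ≢ 0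
    ¬strict⇒a≢0 ¬strict a≡0 with ∃-1-1-singular F₀-uhit n₀≢0 (a≡0⇒c₀ a≡0)
    ... | y , dy , d-y = no-1-1-F₀ ¬strict y dy d-y

    ¬strict⇒b≢0 : ¬ StrictlyFsResolvable F → b ≢ 0
    ¬strict⇒b≢0 ¬strict b≡0 with ∃-1-1-singular G-uhit n₁≢0 (b≡0⇒c₁ b≡0)
    ... | y , dy , d-y = no-1-1-G ¬strict y dy d-y

-- The bounds of the theorem

strictly-resolvable-bound : ∀ {F} → UHIT F → NoDegreeOne F → StrictlyFsResolvable F →
                            ∀ m → NUpper (δ F ℤ.- + 1) m → n F ≤ m + 3
strictly-resolvable-bound U nd (E , v , _ , v∉ , -v∉ , A∈ , B∈ , _ , strict) m
  with fsPair-≅ U v∉ -v∉ A∈ B∈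
... | R , F≅ = FsResolution.bound U nd v∉ -v∉ F≅ (λ {w} → Equivalence.to (strict w))

i+j≤k⇒i≤k-j : ∀ {i j k} → i ℤ.+ j ℤ.≤ k → i ℤ.≤ k ℤ.- j
i+j≤k⇒i≤k-j {i} {j} {k} le = subst (ℤ._≤ k ℤ.- j) (cancel i j) (ℤₚ.+-monoˡ-≤ (- j) le)
  where
  cancel : ∀ i j → i ℤ.+ j ℤ.- j ≡ i
  cancel = solve-∀

theorem1 : (F F0 G : ClauseSet) (C : Clause) →
    NUH F → ClauseReducible F →
    ClauseFactorisation F F0 C G → NontrivialFactorisation F0 G →
    (+ 2 ℤ.≤ δ F) ×
    (StrictlyFsResolvable F →
      ∀ m → NUpper (δ F ℤ.- + 1) m → n F ≤ m + 3) ×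
    (¬ StrictlyFsResolvable F →
      ∀ m₁ m₂ → NUpper (δ F0) m₁ → NUpper (δ G) m₂ →
        n F ≤ m₁ + m₂ + nCommon F0 G + 1) ×
    ((∀ (k' : ℕ) → 2 ≤ k' → + k' ℤ.< δ F → NIs (+ k') (4 * k' ∸ 5)) →
      (StrictlyFsResolvable F → + n F ℤ.≤ + 4 ℤ.* δ F ℤ.- + 6) ×
      (¬ StrictlyFsResolvable F →
        (+ n F ℤ.≤ + 4 ℤ.* δ F ℤ.- + 5 ℤ.- + 3 ℤ.* + nCommon F0 G) ×
        (+ 4 ℤ.* δ F ℤ.- + 5 ℤ.- + 3 ℤ.* + nCommon F0 G ℤ.≤ + 4 ℤ.* δ F ℤ.- + 5)))
theorem1 F F0 G C nuh _ fac (F0≢⊥ , G≢⊥) =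
  subst (+ 2 ℤ.≤_) (sym δF) (ℤ.+≤+ (s≤s (e≥1 U nd Fac n₀≢0 n₁≢0 c₀≡ c₁≡))) ,
  part1 ,
  (λ ¬strict m₁ m₂ → part2 ¬strict) ,
  (λ hyp → part3a hyp , λ ¬strict → part3b hyp ¬strict , drop)
  where
  U : UHIT F
  U = proj₁ (fromNUH nuh)

  nd : NoDegreeOne F
  nd = proj₂ (fromNUH {F} nuh)

  Fac : Factors F F0 G C
  Fac = factors U fac

  open Factors Fac

  n₀≢0 : n F0 ≢ 0
  n₀≢0 = F0≢⊥ ∘ n≡0⇒botSet F₀-uhit

  n₁≢0 : n G ≢ 0
  n₁≢0 = G≢⊥ ∘ n≡0⇒botSet G-uhit

  a b q e : ℕ
  a = proj₁ (deficiency F₀-uhit)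
  b = proj₁ (deficiency G-uhit)
  q = nCommon F0 G
  e = q + a + b

  c₀≡ : c F0 ≡ suc (n F0 + a)
  c₀≡ = proj₂ (deficiency F₀-uhit)

  c₁≡ : c G ≡ suc (n G + b)
  c₁≡ = proj₂ (deficiency G-uhit)

  δF : δ F ≡ + suc e
  δF = δ-value {F} (c-F≡ U nd Fac n₀≢0 n₁≢0 c₀≡ c₁≡)

  Hyp : Set
  Hyp = ∀ (k' : ℕ) → 2 ≤ k' → + k' ℤ.< δ F → NIs (+ k') (4 * k' ∸ 5)

  part1 : StrictlyFsResolvable F → ∀ m → NUpper (δ F ℤ.- + 1) m → n F ≤ m + 3
  part1 = strictly-resolvable-bound U nd

  part2 : ¬ StrictlyFsResolvable F → ∀ {m₁ m₂} → NUpper (δ F0) m₁ → NUpper (δ G) m₂ → n F ≤ m₁ + m₂ + q + 1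
  part2 = nonresolvable-bound U nd Fac n₀≢0 n₁≢0

  4δF : + (4 * suc e) ≡ + 4 ℤ.* δ F
  4δF = trans (ℤₚ.pos-* 4 (suc e)) (cong (+ 4 ℤ.*_) (sym δF))

  upper : Hyp → ∀ {k} → 2 ≤ k → k < suc e → NUpper (+ k) (4 * k ∸ 5)
  upper hyp {k} 2≤k k<e = proj₁ (hyp k 2≤k (subst (+ k ℤ.<_) (sym δF) (ℤ.+<+ k<e)))

  part3a : Hyp → StrictlyFsResolvable F → + n F ℤ.≤ + 4 ℤ.* δ F ℤ.- + 6
  part3a hyp resolvable = i+j≤k⇒i≤k-j (subst (+ (n F + 6) ℤ.≤_) 4δF (ℤ.+≤+ (cases (e ℕ.≟ 1))))
    where
    cases : Dec (e ≡ 1) → n F + 6 ≤ 4 * suc e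
    -- Here the deficiency of `F` is 2, so `Hyp` covers no value, and `4 * 2 - 6` is the bound 2 on
    -- the number of variables.
    cases (yes e≡1) = subst (λ k → n F + 6 ≤ 4 * suc k) (sym e≡1)
      (ℕₚ.+-monoˡ-≤ 6 (e≡1⇒n≤2 U nd Fac n₀≢0 n₁≢0 c₀≡ c₁≡ e≡1))
    cases (no e≢1) = begin
      n F + 6               ≤⟨ ℕₚ.+-monoˡ-≤ 6 (part1 resolvable (4 * e ∸ 5) (subst (λ k → NUpper k (4 * e ∸ 5)) δ-1 (upper hyp 2≤e ℕₚ.≤-refl))) ⟩
      4 * e ∸ 5 + 3 + 6     ≡⟨ value e 2≤e ⟩
      4 * suc e             ∎
      where
      open ℕₚ.≤-Reasoning
      2≤e : 2 ≤ e
      2≤e = ℕₚ.≤∧≢⇒< (e≥1 U nd Fac n₀≢0 n₁≢0 c₀≡ c₁≡) (e≢1 ∘ sym)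
      δ-1 : + e ≡ δ F ℤ.- + 1
      δ-1 = sym (cong (ℤ._- + 1) δF)
      value : ∀ e → 2 ≤ e → 4 * e ∸ 5 + 3 + 6 ≡ 4 * suc e
      value e 2≤e = trans (ℕₚ.+-assoc (4 * e ∸ 5) 3 6) (trans (sym (ℕₚ.+-assoc (4 * e ∸ 5) 5 4))
        (trans (cong (_+ 4) (ℕₚ.m∸n+n≡m {4 * e} {5} (ℕₚ.≤-trans (ℕₚ.m≤m+n 5 3) (ℕₚ.*-monoʳ-≤ 4 2≤e))))
          (trans (ℕₚ.+-comm (4 * e) 4) (sym (ℕₚ.*-suc 4 e)))))

  part3b : Hyp → ¬ StrictlyFsResolvable F → + n F ℤ.≤ + 4 ℤ.* δ F ℤ.- + 5 ℤ.- + 3 ℤ.* + q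
  part3b hyp ¬strict = subst (λ t → + n F ℤ.≤ + 4 ℤ.* δ F ℤ.- + 5 ℤ.- t) (ℤₚ.pos-* 3 q)
    (i+j≤k⇒i≤k-j (i+j≤k⇒i≤k-j {+ (n F + 3 * q)} (subst (+ (n F + 3 * q + 5) ℤ.≤_) 4δF (ℤ.+≤+ le))))
    where
    open ℕₚ.≤-Reasoning
    a≥1 : 1 ≤ a
    a≥1 = ℕₚ.n≢0⇒n>0 (¬strict⇒a≢0 U nd Fac n₀≢0 n₁≢0 c₀≡ c₁≡ ¬strict)
    b≥1 : 1 ≤ b
    b≥1 = ℕₚ.n≢0⇒n>0 (¬strict⇒b≢0 U nd Fac n₀≢0 n₁≢0 c₀≡ c₁≡ ¬strict)
    -- `a≥1` makes the deficiency `suc a` at least 2, and `b≥1` makes it smaller than `suc e`, so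
    -- `Hyp` applies; symmetrically for `G`.
    upper₀ : NUpper (δ F0) (4 * suc a ∸ 5)
    upper₀ = subst (λ k → NUpper k (4 * suc a ∸ 5)) (sym (δ-value {F0} c₀≡))
      (upper hyp (s≤s a≥1) (s≤s (ℕₚ.≤-<-trans (ℕₚ.m≤n+m a q) (ℕₚ.m<m+n (q + a) b≥1))))
    upper₁ : NUpper (δ G) (4 * suc b ∸ 5)
    upper₁ = subst (λ k → NUpper k (4 * suc b ∸ 5)) (sym (δ-value {G} c₁≡))
      (upper hyp (s≤s b≥1) (s≤s (ℕₚ.m<n+m b (ℕₚ.≤-trans a≥1 (ℕₚ.m≤n+m a q)))))
    value : ∀ a b q → 1 ≤ a → 1 ≤ b →
            (4 * suc a ∸ 5) + (4 * suc b ∸ 5) + q + 1 + 3 * q + 5 ≡ 4 * suc (q + a + b)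
    -- With positive `a` and `b` the minuends have the form `8 + 4 * a`, so the truncated
    -- subtraction of 5 is exact.
    value (suc a) (suc b) q _ _ = trans
      (cong₂ (λ s t → s + t + q + 1 + 3 * q + 5) (cong (_∸ 5) (8+ a)) (cong (_∸ 5) (8+ b))) (collect a b q)
      where
      8+ : ∀ a → 4 * (2 + a) ≡ 8 + 4 * a
      8+ = ℕ-solve-∀
      collect : ∀ a b q → (3 + 4 * a) + (3 + 4 * b) + q + 1 + 3 * q + 5 ≡ 4 * (1 + (q + (1 + a) + (1 + b)))
      collect = ℕ-solve-∀
    le : n F + 3 * q + 5 ≤ 4 * suc e
    le = begin
      n F + 3 * q + 5 ≤⟨ ℕₚ.+-monoˡ-≤ 5 (ℕₚ.+-monoˡ-≤ (3 * q) (part2 ¬strict upper₀ upper₁)) ⟩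
      (4 * suc a ∸ 5) + (4 * suc b ∸ 5) + q + 1 + 3 * q + 5 ≡⟨ value a b q a≥1 b≥1 ⟩
      4 * suc e ∎

  drop : + 4 ℤ.* δ F ℤ.- + 5 ℤ.- + 3 ℤ.* + q ℤ.≤ + 4 ℤ.* δ F ℤ.- + 5
  drop = subst (λ t → + 4 ℤ.* δ F ℤ.- + 5 ℤ.- t ℤ.≤ + 4 ℤ.* δ F ℤ.- + 5) (ℤₚ.pos-* 3 q)
    (ℤₚ.i≤j⇒i-k≤j (+ (3 * q)) ℤₚ.≤-refl)
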